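{- Let $G$ be a connected graph with $m$ edges and $m_1$ pendent $2$-length paths. Then $rc(L^2(G))\leq m-m_1$, and equality holds if and only if $G$ is a path of length at least $3$.
   Context: All graphs are simple, finite and undirected. $L(G)$ is the line graph of $G$ and $L^2(G)=L(L(G))$ is the iterated line graph. A pendent $k$-length path of $G$ is a path of length $k$ in $G$ one of whose end vertices has degree $1$ in $G$ and all of whose internal vertices have degree $2$ in $G$. For an edge-colouring of a graph (adjacent edges may receive the same colour), a path is rainbow if no two of its edges have the same colour; the graph is rainbow connected if every two vertices are joined by a rainbow path. The rainbow connection number $rc(H)$ of a connected graph $H$ is the smallest number of colours in an edge-colouring making $H$ rainbow connected. -}

module Defs where

open import Data.Nat.Base using (ℕ; suc; _≤_)
import Data.Nat.Properties as ℕ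
open import Data.Fin.Base using (Fin; toℕ; _<_)
open import Data.Fin.Properties using (_≟_; _<?_; any?)
open import Data.List.Base using (List; []; _∷_; map; length; lookup; filter; allFin; cartesianProduct)
open import Data.List.Relation.Unary.Unique.Propositional using (Unique)
open import Data.Product.Base using (Σ; Σ-syntax; ∃; ∃-syntax; _×_; _,_; proj₁; proj₂)
open import Data.Sum.Base using (_⊎_; inj₁; inj₂)
open import Function.Base using (_∘_)
open import Function.Bundles using (_↔_; _⇔_; module Inverse)
open import Relation.Binary.Core using (Rel)
open import Relation.Binary.Definitions using (Symmetric; Irreflexive; Decidable)
open import Relation.Binary.PropositionalEquality using (_≡_; _≢_; refl; sym; trans)
open import Relation.Nullary.Decidable using (Dec; ¬?; _×-dec_; _⊎-dec_)
open import Level using (0ℓ)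

record Graph : Set₁ where
  field
    order   : ℕ

  V : Set
  V = Fin order

  field
    Adj     : Rel V 0ℓ
    adj?    : Decidable Adj
    adj-sym : Symmetric Adj
    irrefl  : Irreflexive _≡_ Adj

  -- Each edge {u , v} is listed exactly once, as the pair with u < v.
  edges : List (V × V)
  edges = filter (λ (u , v) → (u <? v) ×-dec adj? u v)
                 (cartesianProduct (allFin order) (allFin order))

  size : ℕ
  size = length edges

  -- Edges are referred to by their position in `edges`.
  E : Set
  E = Fin size

  endpoints : E → V × V
  endpoints = lookup edges

  Incident : V → E → Set
  Incident v e = v ≡ proj₁ (endpoints e) ⊎ v ≡ proj₂ (endpoints e)

  incident? : Decidable Incident
  incident? v e = (v ≟ proj₁ (endpoints e)) ⊎-dec (v ≟ proj₂ (endpoints e))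

  Joins : E → V → V → Set
  Joins e u v = endpoints e ≡ (u , v) ⊎ endpoints e ≡ (v , u)

  degree : V → ℕ
  degree v = length (filter (adj? v) (allFin order))

  infixr 5 _∷_
  data Walk : V → V → Set where
    []  : ∀ {u} → Walk u u
    _∷_ : ∀ {u v w} → Σ[ e ∈ E ] Joins e u v → Walk v w → Walk u w

  walkVertices : ∀ {u v} → Walk u v → List V
  walkVertices {u} []      = u ∷ []
  walkVertices {u} (_ ∷ p) = u ∷ walkVertices p

  walkEdges : ∀ {u v} → Walk u v → List E
  walkEdges []            = []
  walkEdges ((e , _) ∷ p) = e ∷ walkEdges p

  IsPath : ∀ {u v} → Walk u v → Set
  IsPath p = Unique (walkVertices p)

  -- The null graph is not connected.
  Connected : Set
  Connected = V × (∀ u v → Σ[ p ∈ Walk u v ] IsPath p)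

  EdgeColouring : ℕ → Set
  EdgeColouring k = E → Fin k

  IsRainbow : ∀ {k} → EdgeColouring k → ∀ {u v} → Walk u v → Set
  IsRainbow c p = Unique (map c (walkEdges p))

  RainbowConnected : ∀ {k} → EdgeColouring k → Set
  RainbowConnected c = ∀ u v → Σ[ p ∈ Walk u v ] (IsPath p × IsRainbow c p)

  -- A path a - b - c and its reversal c - b - a are the same subgraph; the
  -- condition a < c selects one of the two orientations (and forces a ≢ c).
  PendentTwoPath : V × V × V → Set
  PendentTwoPath (a , b , c) =
    a < c × Adj a b × Adj b c × degree b ≡ 2 × (degree a ≡ 1 ⊎ degree c ≡ 1)

  pendentTwoPath? : (t : V × V × V) → Dec (PendentTwoPath t)
  pendentTwoPath? (a , b , c) =
    (a <? c) ×-dec adj? a b ×-dec adj? b c ×-dec (degree b ℕ.≟ 2)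
      ×-dec ((degree a ℕ.≟ 1) ⊎-dec (degree c ℕ.≟ 1))

  pendentTwoPaths : List (V × V × V)
  pendentTwoPaths = filter pendentTwoPath?
    (cartesianProduct (allFin order) (cartesianProduct (allFin order) (allFin order)))

  numPendentTwoPaths : ℕ
  numPendentTwoPaths = length pendentTwoPaths

open Graph using (V; E; Adj; order; size; numPendentTwoPaths; Connected; EdgeColouring; RainbowConnected) public

-- `IsRainbowConnectionNumber H r` says rc(H) = r.  As rc is only defined for
-- connected graphs, no r is a rainbow connection number of a null graph.
IsRainbowConnectionNumber : Graph → ℕ → Set
IsRainbowConnectionNumber H r =
  Connected H × Colourable r × (∀ k → Colourable k → r ≤ k)
  where
  Colourable : ℕ → Set
  Colourable k = Σ[ c ∈ EdgeColouring H k ] RainbowConnected H c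

lineGraph : Graph → Graph
lineGraph G = record
  { order   = G.size
  ; Adj     = λ e f → e ≢ f × ∃[ v ] (G.Incident v e × G.Incident v f)
  ; adj?    = λ e f → ¬? (e ≟ f) ×-dec any? (λ v → G.incident? v e ×-dec G.incident? v f)
  ; adj-sym = λ { (e≢f , v , ve , vf) → (e≢f ∘ sym) , v , vf , ve }
  ; irrefl  = λ { e≡f (e≢f , _) → e≢f e≡f }
  }
  where module G = Graph G

-- The path of length ℓ, on ℓ + 1 vertices.
pathGraph : ℕ → Graph
pathGraph ℓ = record
  { order   = suc ℓ
  ; Adj     = λ i j → suc (toℕ i) ≡ toℕ j ⊎ suc (toℕ j) ≡ toℕ i
  ; adj?    = λ i j → (suc (toℕ i) ℕ.≟ toℕ j) ⊎-dec (suc (toℕ j) ℕ.≟ toℕ i)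
  ; adj-sym = λ { (inj₁ p) → inj₂ p ; (inj₂ p) → inj₁ p }
  ; irrefl  = λ { refl (inj₁ p) → ℕ.1+n≢n p ; refl (inj₂ p) → ℕ.1+n≢n p }
  }

infix 4 _≅_
_≅_ : Graph → Graph → Set
G ≅ H = Σ[ f ∈ V G ↔ V H ] (∀ u v → Adj G u v ⇔ Adj H (Inverse.to f u) (Inverse.to f v))

IsPathOfLength≥3 : Graph → Set
IsPathOfLength≥3 G = ∃[ ℓ ] (3 ≤ ℓ × G ≅ pathGraph ℓ)

{-# OPTIONS --safe #-}

-- Colour an edge of L²(G) joining two pairs of edges of G by the edge e that the
-- pairs share. Two equally coloured edges of a shortest path would allow a shortcut
-- of one step, since any two pairs containing e are adjacent; so shortest paths are
-- rainbow. An edge e of G that is adjacent to only one other edge is never used as a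
-- colour, and the pendent 2-paths provide m₁ such edges.
--
-- If a vertex of G has three neighbours, L(G) contains a triangle xyz, and the three
-- colours x, y, z can be replaced by two: a shortest path uses at most two of them,
-- and these consecutively. The edges coloured x get one colour if they meet the side
-- xy of the triangle and another colour otherwise, and cyclically for y and z; the
-- only clash left, C – xy – yz, is resolved by the detour C – zx – yz.
--
-- Otherwise a maximal path of G visits all vertices, so G is a path or a cycle. In
-- a cycle with m edges, L²(G) is connected by the rainbow walks that avoid one fixed
-- edge of the cycle, so m - 1 colours suffice. For a path of length ℓ, sending a pair
-- of edges to their common vertex moves by at most one vertex along an edge of L²(G),
-- so a path between the extreme pairs has at least ℓ - 2 edges and ℓ - 2 colours.
module Submission where

open import Data.Empty using (⊥)
open import Data.Fin.Base as Fin using (Fin; zero; suc; toℕ)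
import Data.Fin.Properties as Fin
open import Data.List.Base
  using (List; []; _∷_; map; length; lookup; filter; allFin; tabulate; cartesianProduct)
import Data.List.Properties as List
open import Data.List.Membership.Propositional using (_∈_; _∉_; find)
open import Data.List.Membership.Propositional.Properties
  using (∈-lookup; ∈-filter⁺; ∈-filter⁻; ∈-allFin; ∈-cartesianProduct⁺)
open import Data.List.Relation.Unary.All as All using (All; []; _∷_)
import Data.List.Relation.Unary.All.Properties as All
open import Data.List.Relation.Unary.AllPairs as AllPairs using ([]; _∷_)
import Data.List.Relation.Unary.AllPairs.Properties as AllPairs
open import Data.List.Relation.Unary.Any as Any using (here; there; index)
open import Data.List.Relation.Unary.Any.Properties using (lookup-index)
open import Data.List.Relation.Unary.Unique.Propositional using (Unique)
import Data.List.Relation.Unary.Unique.Propositional.Properties as Unique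
open import Data.Nat.Base as ℕ using (ℕ; zero; suc; _+_; _≤_; z≤n; s≤s)
import Data.Nat.Properties as ℕ
open import Data.Product.Base using (Σ-syntax; ∃-syntax; _×_; _,_; proj₁; proj₂)
open import Data.Sum.Base as Sum using (_⊎_; inj₁; inj₂; swap; [_,_]′)
open import Function.Base using (_∘_; case_of_)
open import Function.Bundles using (_⇔_; mk↔ₛ′; mk⇔; module Inverse; module Equivalence)
open import Relation.Binary.Definitions using (tri<; tri≈; tri>)
open import Relation.Binary.PropositionalEquality
open import Relation.Nullary.Decidable using (Dec; yes; no; decidable-stable; ¬?; _×-dec_)
open import Relation.Nullary.Negation using (¬_; contradiction)
open import Defs

-- Counting with duplicate-free lists and finite sets

lookup-injective : ∀ {A : Set} {xs : List A} → Unique xs →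
                   ∀ i j → lookup xs i ≡ lookup xs j → i ≡ j
lookup-injective (x∉ ∷ u) zero    zero    eq = refl
lookup-injective (x∉ ∷ u) zero    (suc j) eq = contradiction eq (All.lookup x∉ (∈-lookup j))
lookup-injective (x∉ ∷ u) (suc i) zero    eq = contradiction (sym eq) (All.lookup x∉ (∈-lookup i))
lookup-injective (x∉ ∷ u) (suc i) (suc j) eq = cong suc (lookup-injective u i j eq)

-- Pigeonhole: looking up the chosen position in `ys` returns the element, so distinct elements get
-- distinct positions.
length-⊆ : ∀ {A : Set} {xs ys : List A} → Unique xs → (∀ {x} → x ∈ xs → x ∈ ys) →
           length xs ≤ length ys
length-⊆ {xs = xs} {ys} u xs⊆ys = Fin.injective⇒≤ {f = position} position-injective
  where
  position : Fin (length xs) → Fin (length ys)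
  position i = index (xs⊆ys (∈-lookup i))

  position-injective : ∀ {i j} → position i ≡ position j → i ≡ j
  position-injective {i} {j} eq = lookup-injective u i j
    (trans (lookup-index (xs⊆ys (∈-lookup i)))
      (trans (cong (lookup ys) eq) (sym (lookup-index (xs⊆ys (∈-lookup j))))))

length-Fin : ∀ {n} {xs : List (Fin n)} → Unique xs → length xs ≤ n
length-Fin {n} {xs} u =
  subst (length xs ≤_) (List.length-tabulate {n = n} (λ i → i)) (length-⊆ u (λ {x} _ → ∈-allFin x))

-- The colours outside `S` are renumbered by their position in `used`. As `used` and `S` are
-- disjoint and duplicate-free, their concatenation fits into `Fin m`. Equal new colours come from
-- equal old ones, so rainbow walks stay rainbow.
discard-colours : ∀ {A : Set} {m} (c : A → Fin m) {S : List (Fin m)} → Unique S →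
                  (∀ a → c a ∉ S) →
                  ∃[ k ] (k + length S ≤ m ×
                          Σ[ c′ ∈ (A → Fin k) ] (∀ {a b} → c′ a ≡ c′ b → c a ≡ c b))
discard-colours {A} {m} c {S} uS c∉S =
  length used , bound , c′ , c′-reflects
  where
  open import Data.List.Membership.DecPropositional {A = Fin m} Fin._≟_ using (_∈?_)

  used : List (Fin m)
  used = filter (λ x → ¬? (x ∈? S)) (allFin m)

  bound : length used + length S ≤ m
  bound = subst (_≤ m) (List.length-++ used)
    (length-Fin (Unique.++⁺ (Unique.filter⁺ _ (Unique.allFin⁺ m)) uS
      λ (v∈used , v∈S) → proj₂ (∈-filter⁻ (λ x → ¬? (x ∈? S)) {xs = allFin m} v∈used) v∈S))

  c∈used : ∀ a → c a ∈ used
  c∈used a = ∈-filter⁺ (λ x → ¬? (x ∈? S)) (∈-allFin (c a)) (c∉S a)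

  c′ : A → Fin (length used)
  c′ a = index (c∈used a)

  c′-reflects : ∀ {a b} → c′ a ≡ c′ b → c a ≡ c b
  c′-reflects {a} {b} eq = trans (lookup-index (c∈used a))
    (trans (cong (lookup used) eq) (sym (lookup-index (c∈used b))))

map-unique : ∀ {A B C : Set} {f : A → B} {g : A → C} →
             (∀ {x y} → g x ≡ g y → f x ≡ f y) →
             ∀ {xs} → Unique (map f xs) → Unique (map g xs)
map-unique g⇒f u = AllPairs.map⁺ (AllPairs.map (_∘ g⇒f) (AllPairs.map⁻ u))

-- Edges, their ends, and vertex degrees

module Edges (G : Graph) where
  open Graph G hiding (V; E; order; size; Adj; EdgeColouring; RainbowConnected)

  adjacent-≢ : ∀ {u v} → Adj G u v → u ≢ v
  adjacent-≢ a eq = irrefl eq a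

  edges-unique : Unique edges
  edges-unique = Unique.filter⁺ _ (Unique.cartesianProduct⁺ (Unique.allFin⁺ _) (Unique.allFin⁺ _))

  endpoints-spec : ∀ e → proj₁ (endpoints e) Fin.< proj₂ (endpoints e) ×
                         Adj G (proj₁ (endpoints e)) (proj₂ (endpoints e))
  endpoints-spec e = proj₂ (∈-filter⁻ (λ (u , v) → (u Fin.<? v) ×-dec adj? u v)
    {xs = cartesianProduct (allFin (order G)) (allFin (order G))} (∈-lookup e))

  edge-at : ∀ {u v} → u Fin.< v → Adj G u v → Σ[ e ∈ E G ] endpoints e ≡ (u , v)
  edge-at {u} {v} u<v uv = index uv∈ , sym (lookup-index uv∈)
    where
    uv∈ : (u , v) ∈ edges
    uv∈ = ∈-filter⁺ (λ (u , v) → (u Fin.<? v) ×-dec adj? u v)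
      (∈-cartesianProduct⁺ (∈-allFin u) (∈-allFin v)) (u<v , uv)

  edge-between : ∀ {u v} → Adj G u v → Σ[ e ∈ E G ] Joins e u v
  edge-between {u} {v} uv with Fin.<-cmp u v
  ... | tri< u<v _ _ = let e , eq = edge-at u<v uv in e , inj₁ eq
  ... | tri≈ _ u≡v _ = contradiction uv (irrefl u≡v)
  ... | tri> _ _ v<u = let e , eq = edge-at v<u (adj-sym uv) in e , inj₂ eq

  joins⇒adj : ∀ {e u v} → Joins e u v → Adj G u v
  joins⇒adj {e} (inj₁ eq) = subst (λ (u , v) → Adj G u v) eq (proj₂ (endpoints-spec e))
  joins⇒adj {e} (inj₂ eq) = adj-sym (subst (λ (u , v) → Adj G u v) eq (proj₂ (endpoints-spec e)))

  joins⇒incidentˡ : ∀ {e u v} → Joins e u v → Incident u e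
  joins⇒incidentˡ (inj₁ eq) = inj₁ (sym (cong proj₁ eq))
  joins⇒incidentˡ (inj₂ eq) = inj₂ (sym (cong proj₂ eq))

  joins⇒incidentʳ : ∀ {e u v} → Joins e u v → Incident v e
  joins⇒incidentʳ {e} j = joins⇒incidentˡ {e} (swap j)

  incident⇒joins : ∀ {e u} → Incident u e → ∃[ v ] Joins e u v
  incident⇒joins (inj₁ refl) = _ , inj₁ refl
  incident⇒joins (inj₂ refl) = _ , inj₂ refl

  incident-joins : ∀ {e u v w} → Joins e u v → Incident w e → w ≡ u ⊎ w ≡ v
  incident-joins (inj₁ refl) i = i
  incident-joins (inj₂ refl) i = swap i

  joins-endpoints : ∀ e → Joins e (proj₁ (endpoints e)) (proj₂ (endpoints e))
  joins-endpoints e = inj₁ refl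

  incident²⇒joins : ∀ {e u v} → u ≢ v → Incident u e → Incident v e → Joins e u v
  incident²⇒joins {e} u≢v ui vi with incident⇒joins {e} ui
  ... | w , j with incident-joins {e} j vi
  ...   | inj₁ v≡u  = contradiction (sym v≡u) u≢v
  ...   | inj₂ refl = j

  -- `edges` is duplicate-free and stores the smaller end first, so the two orientations of one pair
  -- of ends cannot both occur.
  joins-unique : ∀ {e f u v} → Joins e u v → Joins f u v → e ≡ f
  joins-unique {e} {f} (inj₁ p) (inj₁ q) = lookup-injective edges-unique e f (trans p (sym q))
  joins-unique {e} {f} (inj₂ p) (inj₂ q) = lookup-injective edges-unique e f (trans p (sym q))
  joins-unique {e} {f} (inj₁ p) (inj₂ q) = contradiction
    (subst (λ (u , v) → u Fin.< v) q (proj₁ (endpoints-spec f)))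
    (Fin.<-asym (subst (λ (u , v) → u Fin.< v) p (proj₁ (endpoints-spec e))))
  joins-unique {e} {f} (inj₂ p) (inj₁ q) = contradiction
    (subst (λ (u , v) → u Fin.< v) q (proj₁ (endpoints-spec f)))
    (Fin.<-asym (subst (λ (u , v) → u Fin.< v) p (proj₁ (endpoints-spec e))))

  -- Applied to a line graph, this says that two different pairs of edges share at most one edge.
  edge-unique : ∀ {e f u v} → u ≢ v → Incident u e → Incident v e →
                Incident u f → Incident v f → e ≡ f
  edge-unique {e} {f} u≢v ue ve uf vf =
    joins-unique {e} {f} (incident²⇒joins {e} u≢v ue ve) (incident²⇒joins {f} u≢v uf vf)

  distinct-spokes : ∀ {e f v x y} → Joins e v x → Joins f v y → x ≢ y → e ≢ f
  distinct-spokes {e} {f} e-vx f-vy x≢y refl with incident-joins {f} f-vy (joins⇒incidentʳ {e} e-vx)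
  ... | inj₁ x≡v = adjacent-≢ (joins⇒adj {e} e-vx) (sym x≡v)
  ... | inj₂ x≡y = x≢y x≡y

  length-≤-degree : ∀ {v xs} → Unique xs → (∀ {w} → w ∈ xs → Adj G v w) → length xs ≤ degree v
  length-≤-degree u xs⊆ = length-⊆ u λ w∈ → ∈-filter⁺ (adj? _) (∈-allFin _) (xs⊆ w∈)

  degree-≤-length : ∀ {v xs} → (∀ {w} → Adj G v w → w ∈ xs) → degree v ≤ length xs
  degree-≤-length {v} ⊆xs = length-⊆ (Unique.filter⁺ (adj? v) (Unique.allFin⁺ _))
    λ w∈ → ⊆xs (proj₂ (∈-filter⁻ (adj? v) {xs = allFin _} w∈))

  degree-1 : ∀ {v a b} → degree v ≡ 1 → Adj G v a → Adj G v b → a ≡ b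
  degree-1 {v} {a} {b} d va vb with a Fin.≟ b
  ... | yes a≡b = a≡b
  ... | no  a≢b = case subst (2 ≤_) d (length-≤-degree ((a≢b ∷ []) ∷ [] ∷ [])
          λ { (here refl) → va ; (there (here refl)) → vb }) of λ { (s≤s ()) }

  degree-2 : ∀ {v a b c} → degree v ≡ 2 → Adj G v a → Adj G v b → a ≢ b →
             Adj G v c → c ≡ a ⊎ c ≡ b
  degree-2 {v} {a} {b} {c} d va vb a≢b vc with c Fin.≟ a | c Fin.≟ b
  ... | yes c≡a | _       = inj₁ c≡a
  ... | no  c≢a | yes c≡b = inj₂ c≡b
  ... | no  c≢a | no  c≢b = case subst (3 ≤_) d (length-≤-degree
          ((c≢a ∷ c≢b ∷ []) ∷ (a≢b ∷ []) ∷ [] ∷ [])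
          λ { (here refl) → vc ; (there (here refl)) → va ; (there (there (here refl))) → vb })
          of λ { (s≤s (s≤s ())) }

-- Walks, geodesics and rainbow paths

module Walks (G : Graph) where
  open Graph G hiding (V; E; order; size; Adj; EdgeColouring; RainbowConnected)
  open Edges G

  ∣_∣ : ∀ {u v} → Walk u v → ℕ
  ∣ w ∣ = length (walkEdges w)

  Geodesic : ∀ {u v} → Walk u v → Set
  Geodesic {u} {v} w = ∀ (w′ : Walk u v) → ∣ w ∣ ≤ ∣ w′ ∣

  walk? : ∀ n u v → Dec (Σ[ w ∈ Walk u v ] ∣ w ∣ ≡ n)
  walk? zero u v with u Fin.≟ v
  ... | yes refl = yes ([] , refl)
  ... | no  u≢v  = no λ { ([] , _) → u≢v refl }
  walk? (suc n) u v with Fin.any? (λ x → adj? u x ×-dec walk? n x v)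
  ... | yes (x , ux , w , eq) = yes (edge-between ux ∷ w , cong suc eq)
  ... | no  ∄ = no λ { ((q ∷ w) , eq) → ∄ (_ , joins⇒adj {proj₁ q} (proj₂ q) , w , ℕ.suc-injective eq) }

  -- Lengths are tried upwards from 0, and `d` counts the untried ones below the length of `w₀`. If
  -- none of them occurs, `w₀` itself is shortest.
  geodesic : ∀ {u v} → Walk u v → Σ[ w ∈ Walk u v ] Geodesic w
  geodesic {u} {v} w₀ = search ∣ w₀ ∣ 0 (ℕ.+-identityʳ _) (λ _ → z≤n)
    where
    search : ∀ d n → d + n ≡ ∣ w₀ ∣ → (∀ (w : Walk u v) → n ≤ ∣ w ∣) →
             Σ[ w ∈ Walk u v ] Geodesic w
    search zero    n eq lb = w₀ , λ w → subst (_≤ ∣ w ∣) eq (lb w)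
    search (suc d) n eq lb with walk? n u v
    ... | yes (w , refl) = w , lb
    ... | no  ∄ = search d (suc n) (trans (ℕ.+-suc d n) eq)
            λ w → ℕ.≤∧≢⇒< (lb w) λ eq → ∄ (w , sym eq)

  geodesic-tail : ∀ {u x v} (q : Σ[ e ∈ E G ] Joins e u x) (w : Walk x v) →
                  Geodesic (q ∷ w) → Geodesic w
  geodesic-tail q _ g w′ = ℕ.s≤s⁻¹ (g (q ∷ w′))

  infixr 5 _⁀_
  _⁀_ : ∀ {u v w} → Walk u v → Walk v w → Walk u w
  []       ⁀ w′ = w′
  (q ∷ w) ⁀ w′ = q ∷ (w ⁀ w′)

  ∣⁀∣ : ∀ {u v w} (p : Walk u v) (p′ : Walk v w) → ∣ p ⁀ p′ ∣ ≡ ∣ p ∣ + ∣ p′ ∣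
  ∣⁀∣ []       p′ = refl
  ∣⁀∣ (q ∷ p) p′ = cong suc (∣⁀∣ p p′)

  -- Supplies the part of a walk that a shortcut keeps: it starts at an end of `f`, and everything
  -- up to and including `f` is saved.
  suffix-after : ∀ {u v f} (w : Walk u v) → f ∈ walkEdges w →
                 ∃[ x ] (Incident x f × Σ[ w′ ∈ Walk x v ] ∣ w′ ∣ ℕ.< ∣ w ∣)
  suffix-after ((e , j) ∷ w) (here refl) = _ , joins⇒incidentʳ {e} j , w , ℕ.≤-refl
  suffix-after (_ ∷ w)       (there f∈)  =
    let x , i , w′ , lt = suffix-after w f∈ in x , i , w′ , ℕ.m<n⇒m<1+n lt

  module _ {k} (c : EdgeColouring G k) where

    suffix-from : ∀ {u v x} (w : Walk u v) → IsPath w → IsRainbow c w → x ∈ walkVertices w →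
                  Σ[ w′ ∈ Walk x v ] (IsPath w′ × IsRainbow c w′ ×
                                      (∀ {e} → e ∈ walkEdges w′ → e ∈ walkEdges w))
    suffix-from []      p r (here refl) = [] , p , r , λ e∈ → e∈
    suffix-from (q ∷ w) p r (here refl) = q ∷ w , p , r , λ e∈ → e∈
    suffix-from (q ∷ w) (_ ∷ p) (_ ∷ r) (there x∈) =
      let w′ , p′ , r′ , ⊆ = suffix-from w p r x∈ in w′ , p′ , r′ , there ∘ ⊆

    -- Loop erasure: if the new first vertex already lies on the path built so far, only the part
    -- from that vertex on is kept. No edge from outside the walk is introduced, which keeps the
    -- colour of `q` new.
    rainbow-path : ∀ {u v} (w : Walk u v) → IsRainbow c w →
                   Σ[ w′ ∈ Walk u v ] (IsPath w′ × IsRainbow c w′ ×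
                                       (∀ {e} → e ∈ walkEdges w′ → e ∈ walkEdges w))
    rainbow-path []            r = [] , [] ∷ [] , [] , λ e∈ → e∈
    rainbow-path {u} (q ∷ w) (q∉ ∷ r) with rainbow-path w r
    ... | w′ , p′ , r′ , ⊆ with Any.any? (u Fin.≟_) (walkVertices w′)
    ...   | yes u∈ = let w″ , p″ , r″ , ⊆′ = suffix-from w′ p′ r′ u∈
                     in  w″ , p″ , r″ , there ∘ ⊆ ∘ ⊆′
    ...   | no  u∉ = q ∷ w′ , All.¬Any⇒All¬ _ u∉ ∷ p′ ,
              All.map⁺ (All.tabulate λ e∈ → All.lookup (All.map⁻ q∉) (⊆ e∈)) ∷ r′ ,
              λ { (here e≡) → here e≡ ; (there e∈) → there (⊆ e∈) }

  module _ {m} (c : EdgeColouring G m)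
           (rainbow : ∀ u v → Σ[ w ∈ Walk u v ] Unique (map c (walkEdges w))) where

    -- Rainbow walks suffice because their loops can be erased. The colours in `S` never occur and
    -- are discarded.
    rc-bound : ∀ {r} → IsRainbowConnectionNumber G r → ∀ {S} → Unique S → (∀ q → c q ∉ S) →
               r + length S ≤ m
    rc-bound (_ , _ , minimal) {S} uS c∉S =
      let k , k+S≤m , c′ , c′⇒c = discard-colours c uS c∉S
          rainbow′ : RainbowConnected G c′
          rainbow′ u v =
            let w , r = rainbow u v
                w′ , p′ , r′ , _ = rainbow-path c′ w (map-unique c′⇒c r)
            in  w′ , p′ , r′
      in  ℕ.≤-trans (ℕ.+-monoˡ-≤ (length S) (minimal k (c′ , rainbow′))) k+S≤m

-- Rainbow geodesics from shared edges

-- The vertices of K are the edges of a graph on Fin m, and an edge of K is labelled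
-- by the end shared by the two edges it joins.
module Pivoted (K : Graph) {m} (_∈ᵉ_ : Fin m → V K → Set) (pivot : E K → Fin m)
               (pivot-incident : ∀ {q C} → Graph.Incident K C q → pivot q ∈ᵉ C)
               (link : ∀ {C D v} → C ≢ D → v ∈ᵉ C → v ∈ᵉ D →
                       Σ[ q ∈ E K ] (Graph.Joins K q C D × pivot q ≡ v))
               where
  private
    module EK = Edges K
  open Graph K using (Walk; []; _∷_; walkEdges; Joins; Incident)
  open Walks K

  pivot∈ˡ : ∀ {q C D} → Joins q C D → pivot q ∈ᵉ C
  pivot∈ˡ {q} j = pivot-incident {q} (EK.joins⇒incidentˡ {q} j)

  pivot∈ʳ : ∀ {q C D} → Joins q C D → pivot q ∈ᵉ D
  pivot∈ʳ {q} j = pivot-incident {q} (EK.joins⇒incidentʳ {q} j)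

  hop : ∀ {C D v} → v ∈ᵉ C → v ∈ᵉ D → Σ[ w ∈ Walk C D ] ∣ w ∣ ≤ 1
  hop {C} {D} vC vD with C Fin.≟ D
  ... | yes refl = [] , z≤n
  ... | no  C≢D  = let q , j , _ = link C≢D vC vD in (q , j) ∷ [] , s≤s z≤n

  -- With equal pivots, C and the far end of `f` would both contain that pivot. One hop would then
  -- replace `q` and everything up to `f`, which is at least two steps.
  geodesic-pivots : ∀ {C D D′ f} (q : Σ[ e ∈ E K ] Joins e C D) (w : Walk D D′) →
                    Geodesic (q ∷ w) → f ∈ walkEdges w → pivot (proj₁ q) ≢ pivot f
  geodesic-pivots {f = f} q w g f∈ eq =
    let X , X∈f , w′ , w′<w = suffix-after w f∈
        h , h≤1 = hop (pivot∈ˡ {proj₁ q} (proj₂ q)) (subst (_∈ᵉ X) (sym eq) (pivot-incident {f} X∈f))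
    in  ℕ.<-irrefl refl (begin-strict
          ∣ q ∷ w ∣       ≤⟨ g (h ⁀ w′) ⟩
          ∣ h ⁀ w′ ∣      ≡⟨ ∣⁀∣ h w′ ⟩
          ∣ h ∣ + ∣ w′ ∣  ≤⟨ ℕ.+-monoˡ-≤ ∣ w′ ∣ h≤1 ⟩
          suc ∣ w′ ∣      <⟨ s≤s w′<w ⟩
          suc ∣ w ∣       ∎)
    where open ℕ.≤-Reasoning

  -- If X contained both pivots, two hops by way of X would lead from C to the far end of `f`,
  -- replacing at least three steps.
  geodesic-distant : ∀ {C D D′ D″ f} (q₁ : Σ[ e ∈ E K ] Joins e C D)
                     (q₂ : Σ[ e ∈ E K ] Joins e D D′) (w : Walk D′ D″) →
                     Geodesic (q₁ ∷ q₂ ∷ w) → f ∈ walkEdges w →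
                     ∀ {X} → pivot (proj₁ q₁) ∈ᵉ X → pivot f ∈ᵉ X → ⊥
  geodesic-distant {f = f} q₁ q₂ w g f∈ 1∈X f∈X =
    let Y , Y∈f , w′ , w′<w = suffix-after w f∈
        h , h≤1 = hop (pivot∈ˡ {proj₁ q₁} (proj₂ q₁)) 1∈X
        h′ , h′≤1 = hop f∈X (pivot-incident {f} Y∈f)
    in  ℕ.<-irrefl refl (begin-strict
          ∣ q₁ ∷ q₂ ∷ w ∣           ≤⟨ g (h ⁀ h′ ⁀ w′) ⟩
          ∣ h ⁀ h′ ⁀ w′ ∣           ≡⟨ ∣⁀∣ h (h′ ⁀ w′) ⟩
          ∣ h ∣ + ∣ h′ ⁀ w′ ∣       ≡⟨ cong (∣ h ∣ +_) (∣⁀∣ h′ w′) ⟩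
          ∣ h ∣ + (∣ h′ ∣ + ∣ w′ ∣) ≤⟨ ℕ.+-mono-≤ h≤1 (ℕ.+-monoˡ-≤ ∣ w′ ∣ h′≤1) ⟩
          suc (suc ∣ w′ ∣)          <⟨ s≤s (s≤s w′<w) ⟩
          suc (suc ∣ w ∣)           ∎)
    where open ℕ.≤-Reasoning

  -- A replacement for two clashing consecutive edges. It again takes two steps, so a geodesic stays
  -- a geodesic.
  Detour : (Fin m → Set) → (E K → Fin m) → V K → V K → Set
  Detour In c C D = ∃[ X ] Σ[ q₁ ∈ E K ] Σ[ q₂ ∈ E K ]
    (Joins q₁ C X × Joins q₂ X D × In (pivot q₁) × In (pivot q₂) × c q₁ ≢ c q₂)

  -- A colouring that refines the pivots up to identifications inside a set of
  -- pairwise adjacent pivots: on a geodesic at most two consecutive edges have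
  -- their pivots in that set, and a detour separates their colours.
  module _ (c : E K → Fin m) (In : Fin m → Set)
           (In-close : ∀ {x y} → In x → In y → ∃[ X ] (x ∈ᵉ X × y ∈ᵉ X))
           (c-reflects : ∀ {q f} → c q ≡ c f → pivot q ≡ pivot f ⊎ In (pivot q) × In (pivot f))
           (detour : ∀ {C X D q₁ q₂} → Joins q₁ C X → Joins q₂ X D →
                     C ≢ D → ¬ Adj K C D → In (pivot q₁) → In (pivot q₂) →
                     pivot q₁ ≢ pivot q₂ → c q₁ ≡ c q₂ → Detour In c C D)
    where

    -- Only consecutive edges of a geodesic can clash: equal pivots allow a one-step shortcut, and
    -- two pivots in `In` lie in a common X.
    distant-colours : ∀ {C D D′ D″ f} (q₁ : Σ[ e ∈ E K ] Joins e C D)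
                      (q₂ : Σ[ e ∈ E K ] Joins e D D′) (w : Walk D′ D″) →
                      Geodesic (q₁ ∷ q₂ ∷ w) → f ∈ walkEdges w → c (proj₁ q₁) ≢ c f
    distant-colours q₁ q₂ w g f∈ eq with c-reflects eq
    ... | inj₁ p≡p       = geodesic-pivots q₁ (q₂ ∷ w) g (there f∈) p≡p
    ... | inj₂ (in₁ , in₂) =
          let _ , 1∈X , f∈X = In-close in₁ in₂ in geodesic-distant q₁ q₂ w g f∈ 1∈X f∈X

    -- Induction on the geodesic. The tail is made rainbow first; then at most the first two edges
    -- clash, and a detour replaces them. The length is part of the claim so that the result is
    -- again a geodesic.
    rainbow-geodesic : ∀ {C D} (w : Walk C D) → Geodesic w →
                       Σ[ w′ ∈ Walk C D ] (∣ w′ ∣ ≡ ∣ w ∣ × Unique (map c (walkEdges w′)))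
    rainbow-geodesic []      g = [] , refl , []
    rainbow-geodesic (q ∷ w) g with rainbow-geodesic w (geodesic-tail q w g)
    ... | w₁ , l₁ , u₁ with Any.any? (λ f → c (proj₁ q) Fin.≟ c f) (walkEdges w₁)
    ...   | no ∄ = q ∷ w₁ , cong suc l₁ , All.map⁺ (All.¬Any⇒All¬ _ ∄) ∷ u₁
    rainbow-geodesic (q@(q₁ , j₁) ∷ w) g | (q₂ , j₂) ∷ w₂ , l₁ , _ ∷ u₂ | yes (here eq) =
      rerouted (c-reflects eq)
      where
      -- Being a geodesic depends on the length only, so the rainbow tail may stand in for `w`.
      g₁ : Geodesic ((q₁ , j₁) ∷ (q₂ , j₂) ∷ w₂)
      g₁ w′ = subst (_≤ ∣ w′ ∣) (cong suc (sym l₁)) (g w′)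

      distinct : pivot q₁ ≢ pivot q₂
      distinct = geodesic-pivots (q₁ , j₁) ((q₂ , j₂) ∷ w₂) g₁ (here refl)

      C≢D : ∀ {C D D′} {w₂ : Walk D D′} → (∀ (w′ : Walk C D′) → suc (suc ∣ w₂ ∣) ≤ ∣ w′ ∣) → C ≢ D
      C≢D {w₂ = w₂} g refl = ℕ.<-irrefl refl (ℕ.≤-trans (ℕ.n≤1+n _) (g w₂))

      rerouted : pivot q₁ ≡ pivot q₂ ⊎ In (pivot q₁) × In (pivot q₂) → _
      rerouted (inj₁ p≡p) = contradiction p≡p distinct
      rerouted (inj₂ (in₁ , in₂)) =
        let X , q₁′ , q₂′ , j₁′ , j₂′ , in₁′ , in₂′ , c≢ =
              detour {q₁ = q₁} {q₂} j₁ j₂ (C≢D {w₂ = w₂} g₁)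
                (λ adj → ℕ.<-irrefl refl (g₁ (EK.edge-between adj ∷ w₂))) in₁ in₂
                distinct eq
            g₂ : Geodesic ((q₁′ , j₁′) ∷ (q₂′ , j₂′) ∷ w₂)
            g₂ = g₁
        in  (q₁′ , j₁′) ∷ (q₂′ , j₂′) ∷ w₂ , cong suc l₁ ,
            (c≢ ∷ All.map⁺ (All.tabulate (distant-colours (q₁′ , j₁′) (q₂′ , j₂′) w₂ g₂))) ∷
            All.map⁺ (All.tabulate λ f∈ eq′ → case c-reflects eq′ of λ
              { (inj₁ p≡p) → geodesic-pivots (q₂′ , j₂′) w₂
                  (geodesic-tail (q₁′ , j₁′) ((q₂′ , j₂′) ∷ w₂) g₂) f∈ p≡p
              -- `f` may directly follow the second detour edge, so the contradiction comes from the
              -- first one: its pivot is in `In` as well, and it is not consecutive with `f`.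
              ; (inj₂ (_ , in-f)) → let _ , 1∈Y , f∈Y = In-close in₁′ in-f
                                    in  geodesic-distant (q₁′ , j₁′) (q₂′ , j₂′) w₂ g₂ f∈ 1∈Y f∈Y }) ∷
            u₂
    rainbow-geodesic (q ∷ w) g | q₂ ∷ w₂ , l₁ , u₁ | yes (there ∃f) =
      let _ , f∈ , eq = find ∃f
      in  contradiction eq (distant-colours q q₂ w₂
            (λ w′ → subst (_≤ ∣ w′ ∣) (cong suc (sym l₁)) (g w′)) f∈)

    recoloured-bound : ∀ {r} → IsRainbowConnectionNumber K r → ∀ {S} → Unique S →
                       (∀ q → c q ∉ S) → r + length S ≤ m
    recoloured-bound rc@((_ , connected) , _) =
      rc-bound c (λ C D → let w , g = geodesic (proj₁ (connected C D))
                              w′ , _ , u = rainbow-geodesic w g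
                          in  w′ , u) rc

-- Colouring a line graph by shared ends, and the saving at a triangle

module LineGraphColouring (H : Graph) where
  private
    K = lineGraph H
    module EH = Edges H
    module EK = Edges K
    open Graph H using () renaming (Incident to _∈ᵉ_; Joins to Joinsᴴ)
    open Graph K using (Joins; Incident; irrefl; incident?)
    open Walks K

  abstract
    -- For H = L(G) the pivot is an edge of G, and these are the colours of L²(G). For H = G it is
    -- the vertex at which two edges meet.
    pivot : E K → V H
    pivot q = proj₁ (proj₂ (proj₂ (EK.endpoints-spec q)))

    pivot-incident : ∀ {q C} → Incident C q → pivot q ∈ᵉ C
    pivot-incident {q} (inj₁ refl) = proj₁ (proj₂ (proj₂ (proj₂ (EK.endpoints-spec q))))
    pivot-incident {q} (inj₂ refl) = proj₂ (proj₂ (proj₂ (proj₂ (EK.endpoints-spec q))))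

  pivot∈ˡ : ∀ {q C D} → Joins q C D → pivot q ∈ᵉ C
  pivot∈ˡ {q} j = pivot-incident {q} (EK.joins⇒incidentˡ {q} j)

  pivot∈ʳ : ∀ {q C D} → Joins q C D → pivot q ∈ᵉ D
  pivot∈ʳ {q} j = pivot-incident {q} (EK.joins⇒incidentʳ {q} j)

  pivot-unique : ∀ {q C D v} → Joins q C D → v ∈ᵉ C → v ∈ᵉ D → pivot q ≡ v
  pivot-unique {q} {C} {D} {v} j vC vD = decidable-stable (pivot q Fin.≟ v) λ ≢v →
    irrefl (EH.edge-unique {C} {D} ≢v (pivot∈ˡ {q} j) vC (pivot∈ʳ {q} j) vD)
      (EK.joins⇒adj {q} j)

  link : ∀ {C D v} → C ≢ D → v ∈ᵉ C → v ∈ᵉ D → Σ[ q ∈ E K ] (Joins q C D × pivot q ≡ v)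
  link C≢D vC vD = let q , j = EK.edge-between (C≢D , _ , vC , vD)
                   in  q , j , pivot-unique {q} j vC vD

  open Pivoted K _∈ᵉ_ pivot (λ {q} {C} → pivot-incident {q} {C}) link public
    using (Detour; recoloured-bound)

  Leaf : V H → Set
  Leaf x = ∀ {f f′} → Adj H x f → Adj H x f′ → f ≡ f′

  -- The pivot lies on two different edges of `H`, whose other ends are two different neighbours
  -- because `H` is simple.
  pivot-not-leaf : ∀ q → ¬ Leaf (pivot q)
  pivot-not-leaf q leaf =
    let C , D = Graph.endpoints K q
        j = EK.joins-endpoints q
        a , C-xa = EH.incident⇒joins {C} (pivot∈ˡ {q} j)
        b , D-xb = EH.incident⇒joins {D} (pivot∈ʳ {q} j)
        a≡b = leaf (EH.joins⇒adj {C} C-xa) (EH.joins⇒adj {D} D-xb)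
    in  irrefl (EH.joins-unique {C} {D} C-xa (subst (Joinsᴴ D _) (sym a≡b) D-xb))
          (EK.joins⇒adj {q} j)

  -- The pivots themselves are the colours. No two of them are identified, so `In` is empty and no
  -- detour arises.
  leaf-bound : ∀ {r} → IsRainbowConnectionNumber K r → ∀ {S} → Unique S → All Leaf S →
               r + length S ≤ order H
  leaf-bound rc uS leaves =
    recoloured-bound pivot (λ _ → ⊥) (λ ()) inj₁ (λ _ _ _ _ ()) rc uS
      (λ q q∈S → pivot-not-leaf q (All.lookup leaves q∈S))

  -- The triangle is traversed from x to y to z. At each corner, A marks the edges of `K` that meet
  -- the side leaving the corner in this direction, and B marks the others. The cyclic form lets
  -- `rotate` reduce all pairs of corners to x and y.
  record Oriented (c : E K → V H) (A B x y z : V H) : Set where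
    field
      {xy yz zx} : V K
      join-xy : Joinsᴴ xy x y
      join-yz : Joinsᴴ yz y z
      join-zx : Joinsᴴ zx z x
      forth-x : ∀ {q} → pivot q ≡ x → Incident xy q → c q ≡ A
      back-x  : ∀ {q} → pivot q ≡ x → ¬ Incident xy q → c q ≡ B
      forth-y : ∀ {q} → pivot q ≡ y → Incident yz q → c q ≡ A
      back-y  : ∀ {q} → pivot q ≡ y → ¬ Incident yz q → c q ≡ B
      forth-z : ∀ {q} → pivot q ≡ z → Incident zx q → c q ≡ A
      back-z  : ∀ {q} → pivot q ≡ z → ¬ Incident zx q → c q ≡ B

  rotate : ∀ {c A B x y z} → Oriented c A B x y z → Oriented c A B y z x
  rotate o = record
    { join-xy = join-yz ; join-yz = join-zx ; join-zx = join-xy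
    ; forth-x = forth-y ; back-x = back-y
    ; forth-y = forth-z ; back-y = back-z
    ; forth-z = forth-x ; back-z = back-x }
    where open Oriented o

  Corner : V H → V H → V H → V H → Set
  Corner x y z p = p ≡ x ⊎ p ≡ y ⊎ p ≡ z

  module _ {c A B x y z} (A≢B : A ≢ B) (o : Oriented c A B x y z) where
    open Oriented o

    module _ {C X D q₁ q₂} (j₁ : Joins q₁ C X) (j₂ : Joins q₂ X D)
             (C≢D : C ≢ D) (C≁D : ¬ Adj K C D)
             (p₁ : pivot q₁ ≡ x) (p₂ : pivot q₂ ≡ y) (same : c q₁ ≡ c q₂) where

      -- X contains x and y, so X is the side xy and `q₁` has colour A. Hence `q₂` has colour A too
      -- and meets yz, which forces D = yz. Going through zx instead gives B at x, since neither C
      -- nor zx is xy, and A at z.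
      detour-forth : ∃[ Y ] Σ[ q₁′ ∈ E K ] Σ[ q₂′ ∈ E K ]
        (Joins q₁′ C Y × Joins q₂′ Y D × pivot q₁′ ≡ x × pivot q₂′ ≡ z × c q₁′ ≢ c q₂′)
      detour-forth = result (incident? yz q₂)
        where
        x≢y = EH.adjacent-≢ (EH.joins⇒adj {xy} join-xy)
        y≢z = EH.adjacent-≢ (EH.joins⇒adj {yz} join-yz)
        z≢x = EH.adjacent-≢ (EH.joins⇒adj {zx} join-zx)

        X≡xy : X ≡ xy
        X≡xy = EH.edge-unique {X} {xy} x≢y
          (subst (_∈ᵉ X) p₁ (pivot∈ʳ {q₁} j₁)) (subst (_∈ᵉ X) p₂ (pivot∈ˡ {q₂} j₂))
          (EH.joins⇒incidentˡ {xy} join-xy) (EH.joins⇒incidentʳ {xy} join-xy)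

        cq₁≡A : c q₁ ≡ A
        cq₁≡A = forth-x {q₁} p₁ (subst (λ e → Incident e q₁) X≡xy (EK.joins⇒incidentʳ {q₁} j₁))

        z∈xy⇒⊥ : ¬ (z ∈ᵉ xy)
        z∈xy⇒⊥ z∈ with EH.incident-joins {xy} join-xy z∈
        ... | inj₁ z≡x = z≢x z≡x
        ... | inj₂ z≡y = y≢z (sym z≡y)

        z∈zx = EH.joins⇒incidentˡ {zx} join-zx
        x∈zx = EH.joins⇒incidentʳ {zx} join-zx
        z∈yz = EH.joins⇒incidentʳ {yz} join-yz

        yz≢X : yz ≢ X
        yz≢X refl = z∈xy⇒⊥ (subst (z ∈ᵉ_) X≡xy z∈yz)

        zx≢xy : zx ≢ xy
        zx≢xy eq = z∈xy⇒⊥ (subst (z ∈ᵉ_) eq z∈zx)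

        y∈zx⇒⊥ : ¬ (y ∈ᵉ zx)
        y∈zx⇒⊥ y∈ with EH.incident-joins {zx} join-zx y∈
        ... | inj₁ y≡z = y≢z y≡z
        ... | inj₂ y≡x = x≢y (sym y≡x)

        zx≢yz : zx ≢ yz
        zx≢yz eq = y∈zx⇒⊥ (subst (y ∈ᵉ_) (sym eq) (EH.joins⇒incidentˡ {yz} join-yz))

        result : Dec (Incident yz q₂) → _
        result (no ∌)  = contradiction (trans (sym cq₁≡A) (trans same (back-y {q₂} p₂ ∌))) A≢B
        result (yes ∋) = [ (λ yz≡X → contradiction yz≡X yz≢X) , detour ]′
                           (EK.incident-joins {q₂} j₂ ∋)
          where
          detour : yz ≡ D → _
          detour yz≡D =
            let z∈D = subst (z ∈ᵉ_) yz≡D z∈yz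
                -- If C were zx, it would share z with D = yz and so be adjacent to D.
                C≢zx = λ C≡zx → C≁D (C≢D , z , subst (z ∈ᵉ_) (sym C≡zx) z∈zx , z∈D)
                q₁′ , j₁′ , p₁′ = link C≢zx (subst (_∈ᵉ C) p₁ (pivot∈ˡ {q₁} j₁)) x∈zx
                q₂′ , j₂′ , p₂′ = link (λ zx≡D → zx≢yz (trans zx≡D (sym yz≡D))) z∈zx z∈D
                C≢X = EK.adjacent-≢ (EK.joins⇒adj {q₁} j₁)
                xy∉q₁′ : ¬ Incident xy q₁′
                xy∉q₁′ xy∈ = [ (λ xy≡C → C≢X (trans (sym xy≡C) (sym X≡xy)))
                             , (λ xy≡zx → zx≢xy (sym xy≡zx)) ]′
                             (EK.incident-joins {q₁′} j₁′ xy∈)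
            in  zx , q₁′ , q₂′ , j₁′ , j₂′ , p₁′ , p₂′ ,
                λ eq → A≢B (trans (sym (forth-z {q₂′} p₂′ (EK.joins⇒incidentˡ {q₂′} j₂′)))
                             (trans (sym eq) (back-x {q₁′} p₁′ xy∉q₁′)))

    detour-xy : ∀ {C X D q₁ q₂} → Joins q₁ C X → Joins q₂ X D → C ≢ D → ¬ Adj K C D →
                (pivot q₁ ≡ x × pivot q₂ ≡ y) ⊎ (pivot q₁ ≡ y × pivot q₂ ≡ x) →
                c q₁ ≡ c q₂ → Detour (Corner x y z) c C D
    detour-xy {q₁ = q₁} {q₂} j₁ j₂ C≢D C≁D (inj₁ (p₁ , p₂)) same =
      let Y , q₁′ , q₂′ , j₁′ , j₂′ , p₁′ , p₂′ , c≢ =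
            detour-forth {q₁ = q₁} {q₂} j₁ j₂ C≢D C≁D p₁ p₂ same
      in  Y , q₁′ , q₂′ , j₁′ , j₂′ , inj₁ p₁′ , inj₂ (inj₂ p₂′) , c≢
    detour-xy {q₁ = q₁} {q₂} j₁ j₂ C≢D C≁D (inj₂ (p₁ , p₂)) same =
      let Y , q₁′ , q₂′ , j₁′ , j₂′ , p₁′ , p₂′ , c≢ =
            -- The walk is read backwards, and the detour found is reversed again.
            detour-forth {q₁ = q₂} {q₁} (swap j₂) (swap j₁) (C≢D ∘ sym)
              (C≁D ∘ Graph.adj-sym K) p₂ p₁ (sym same)
      in  Y , q₂′ , q₁′ , swap j₂′ , swap j₁′ , inj₂ (inj₂ p₂′) , inj₁ p₁′ , c≢ ∘ sym

  corner-rotate : ∀ {x y z p} → Corner y z x p → Corner x y z p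
  corner-rotate (inj₁ p≡y)        = inj₂ (inj₁ p≡y)
  corner-rotate (inj₂ (inj₁ p≡z)) = inj₂ (inj₂ p≡z)
  corner-rotate (inj₂ (inj₂ p≡x)) = inj₁ p≡x

  detour-rotate : ∀ {x y z c C D} → Detour (Corner y z x) c C D → Detour (Corner x y z) c C D
  detour-rotate (X , q₁ , q₂ , j₁ , j₂ , in₁ , in₂ , c≢) =
    X , q₁ , q₂ , j₁ , j₂ , corner-rotate in₁ , corner-rotate in₂ , c≢

  -- Any two different corners become the first two, in some order, after a suitable rotation of the
  -- triangle.
  triangle-detour : ∀ {c A B x y z} → A ≢ B → Oriented c A B x y z →
    ∀ {C X D q₁ q₂} → Joins q₁ C X → Joins q₂ X D → C ≢ D → ¬ Adj K C D →
    Corner x y z (pivot q₁) → Corner x y z (pivot q₂) → pivot q₁ ≢ pivot q₂ → c q₁ ≡ c q₂ →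
    Detour (Corner x y z) c C D
  triangle-detour {c} {x = x} {y} {z} A≢B o {q₁ = q₁} {q₂} j₁ j₂ C≢D C≁D in₁ in₂ p≢p same = go in₁ in₂
    where
    on-xy = λ ps → detour-xy A≢B o {q₁ = q₁} {q₂} j₁ j₂ C≢D C≁D ps same
    on-yz = λ ps → detour-rotate
      (detour-xy A≢B (rotate o) {q₁ = q₁} {q₂} j₁ j₂ C≢D C≁D ps same)
    on-zx = λ ps → detour-rotate (detour-rotate
      (detour-xy A≢B (rotate (rotate o)) {q₁ = q₁} {q₂} j₁ j₂ C≢D C≁D ps same))

    go : Corner x y z (pivot q₁) → Corner x y z (pivot q₂) → Detour (Corner x y z) c _ _
    go (inj₁ p₁)        (inj₁ p₂)        = contradiction (trans p₁ (sym p₂)) p≢p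
    go (inj₁ p₁)        (inj₂ (inj₁ p₂)) = on-xy (inj₁ (p₁ , p₂))
    go (inj₁ p₁)        (inj₂ (inj₂ p₂)) = on-zx (inj₂ (p₁ , p₂))
    go (inj₂ (inj₁ p₁)) (inj₁ p₂)        = on-xy (inj₂ (p₁ , p₂))
    go (inj₂ (inj₁ p₁)) (inj₂ (inj₁ p₂)) = contradiction (trans p₁ (sym p₂)) p≢p
    go (inj₂ (inj₁ p₁)) (inj₂ (inj₂ p₂)) = on-yz (inj₁ (p₁ , p₂))
    go (inj₂ (inj₂ p₁)) (inj₁ p₂)        = on-zx (inj₁ (p₁ , p₂))
    go (inj₂ (inj₂ p₁)) (inj₂ (inj₁ p₂)) = on-yz (inj₂ (p₁ , p₂))
    go (inj₂ (inj₂ p₁)) (inj₂ (inj₂ p₂)) = contradiction (trans p₁ (sym p₂)) p≢p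

  module _ {x y z} (x~y : Adj H x y) (y~z : Adj H y z) (z~x : Adj H z x) where
    private
      xy = EH.edge-between x~y
      yz = EH.edge-between y~z
      zx = EH.edge-between z~x

      -- The colours A and B are x and y themselves, which sets z free.
      shade : ∀ {P : Set} → Dec P → V H
      shade (yes _) = x
      shade (no  _) = y

      -- The decisions are arguments so that the lemmas on `colour` can split on them.
      paint : ∀ {p} → E K → Dec (p ≡ x) → Dec (p ≡ y) → Dec (p ≡ z) → V H
      paint q (yes _) _       _       = shade (incident? (proj₁ xy) q)
      paint q (no _)  (yes _) _       = shade (incident? (proj₁ yz) q)
      paint q (no _)  (no _)  (yes _) = shade (incident? (proj₁ zx) q)
      paint q (no _)  (no _)  (no _)  = pivot q

      colour : E K → V H
      colour q = paint q (pivot q Fin.≟ x) (pivot q Fin.≟ y) (pivot q Fin.≟ z)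

      shade-yes : ∀ {P : Set} (P? : Dec P) → P → shade P? ≡ x
      shade-yes (yes _) _ = refl
      shade-yes (no ¬p) p = contradiction p ¬p

      shade-no : ∀ {P : Set} (P? : Dec P) → ¬ P → shade P? ≡ y
      shade-no (no _)  _  = refl
      shade-no (yes p) ¬p = contradiction p ¬p

      shade-xy : ∀ {P : Set} (P? : Dec P) → shade P? ≡ x ⊎ shade P? ≡ y
      shade-xy (yes _) = inj₁ refl
      shade-xy (no _)  = inj₂ refl

      x≢y = EH.adjacent-≢ x~y
      y≢z = EH.adjacent-≢ y~z
      z≢x = EH.adjacent-≢ z~x

      colour-x : ∀ {q} → pivot q ≡ x → colour q ≡ shade (incident? (proj₁ xy) q)
      colour-x {q} p≡x = go (pivot q Fin.≟ x)
        where
        go : ∀ x? {y? z?} → paint q x? y? z? ≡ shade (incident? (proj₁ xy) q)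
        go (yes _)  = refl
        go (no p≢x) = contradiction p≡x p≢x

      colour-y : ∀ {q} → pivot q ≡ y → colour q ≡ shade (incident? (proj₁ yz) q)
      colour-y {q} p≡y = go (pivot q Fin.≟ x) (pivot q Fin.≟ y)
        where
        go : ∀ x? y? {z?} → paint q x? y? z? ≡ shade (incident? (proj₁ yz) q)
        go (yes p≡x) _        = contradiction (trans (sym p≡x) p≡y) x≢y
        go (no _)    (yes _)  = refl
        go (no _)    (no p≢y) = contradiction p≡y p≢y

      colour-z : ∀ {q} → pivot q ≡ z → colour q ≡ shade (incident? (proj₁ zx) q)
      colour-z {q} p≡z = go (pivot q Fin.≟ x) (pivot q Fin.≟ y) (pivot q Fin.≟ z)
        where
        go : ∀ x? y? z? → paint q x? y? z? ≡ shade (incident? (proj₁ zx) q)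
        go (yes p≡x) _         _        = contradiction (trans (sym p≡z) p≡x) z≢x
        go (no _)    (yes p≡y) _        = contradiction (trans (sym p≡y) p≡z) y≢z
        go (no _)    (no _)    (yes _)  = refl
        go (no _)    (no _)    (no p≢z) = contradiction p≡z p≢z

      colour-spec : ∀ q → (Corner x y z (pivot q) × (colour q ≡ x ⊎ colour q ≡ y)) ⊎
                          (¬ Corner x y z (pivot q) × colour q ≡ pivot q)
      colour-spec q = go (pivot q Fin.≟ x) (pivot q Fin.≟ y) (pivot q Fin.≟ z)
        where
        go : ∀ x? y? z? →
             (Corner x y z (pivot q) × (paint q x? y? z? ≡ x ⊎ paint q x? y? z? ≡ y)) ⊎
             (¬ Corner x y z (pivot q) × paint q x? y? z? ≡ pivot q)
        go (yes p≡x) _         _         = inj₁ (inj₁ p≡x , shade-xy (incident? (proj₁ xy) q))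
        go (no _)    (yes p≡y) _         = inj₁ (inj₂ (inj₁ p≡y) , shade-xy (incident? (proj₁ yz) q))
        go (no _)    (no _)    (yes p≡z) = inj₁ (inj₂ (inj₂ p≡z) , shade-xy (incident? (proj₁ zx) q))
        go (no p≢x)  (no p≢y)  (no p≢z)  = inj₂ ([ p≢x , [ p≢y , p≢z ]′ ]′ , refl)

      oriented : Oriented colour x y x y z
      oriented = record
        { join-xy = proj₂ xy ; join-yz = proj₂ yz ; join-zx = proj₂ zx
        ; forth-x = λ {q} p i → trans (colour-x {q} p) (shade-yes (incident? (proj₁ xy) q) i)
        ; back-x  = λ {q} p i → trans (colour-x {q} p) (shade-no (incident? (proj₁ xy) q) i)
        ; forth-y = λ {q} p i → trans (colour-y {q} p) (shade-yes (incident? (proj₁ yz) q) i)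
        ; back-y  = λ {q} p i → trans (colour-y {q} p) (shade-no (incident? (proj₁ yz) q) i)
        ; forth-z = λ {q} p i → trans (colour-z {q} p) (shade-yes (incident? (proj₁ zx) q) i)
        ; back-z  = λ {q} p i → trans (colour-z {q} p) (shade-no (incident? (proj₁ zx) q) i) }

      xy-corner : ∀ {p} → p ≡ x ⊎ p ≡ y → Corner x y z p
      xy-corner (inj₁ p≡x) = inj₁ p≡x
      xy-corner (inj₂ p≡y) = inj₂ (inj₁ p≡y)

      -- Pivots outside the triangle keep their own name as colour, which is never x or y, so they
      -- cannot clash with a corner.
      reflects : ∀ {q f} → colour q ≡ colour f →
                 pivot q ≡ pivot f ⊎ Corner x y z (pivot q) × Corner x y z (pivot f)
      reflects {q} {f} eq with colour-spec q | colour-spec f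
      ... | inj₁ (in₁ , _)   | inj₁ (in₂ , _)   = inj₂ (in₁ , in₂)
      ... | inj₂ (_ , c≡p)   | inj₂ (_ , c≡p′)  = inj₁ (trans (sym c≡p) (trans eq c≡p′))
      ... | inj₁ (_ , cxy)   | inj₂ (¬in , c≡p) =
            contradiction (xy-corner (subst (λ p → p ≡ x ⊎ p ≡ y) (trans eq c≡p) cxy)) ¬in
      ... | inj₂ (¬in , c≡p) | inj₁ (_ , cxy)   =
            contradiction (xy-corner (subst (λ p → p ≡ x ⊎ p ≡ y) (trans (sym eq) c≡p) cxy)) ¬in

      close : ∀ {p p′} → Corner x y z p → Corner x y z p′ → ∃[ X ] (p ∈ᵉ X × p′ ∈ᵉ X)
      close in₁ in₂ = go in₁ in₂
        where
        ˡ : ∀ {u v} (e : Σ[ X ∈ V K ] Joinsᴴ X u v) → u ∈ᵉ proj₁ e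
        ˡ (X , j) = EH.joins⇒incidentˡ {X} j
        ʳ : ∀ {u v} (e : Σ[ X ∈ V K ] Joinsᴴ X u v) → v ∈ᵉ proj₁ e
        ʳ (X , j) = EH.joins⇒incidentʳ {X} j
        go : ∀ {p p′} → Corner x y z p → Corner x y z p′ → ∃[ X ] (p ∈ᵉ X × p′ ∈ᵉ X)
        go (inj₁ refl)        (inj₁ refl)        = proj₁ xy , ˡ xy , ˡ xy
        go (inj₁ refl)        (inj₂ (inj₁ refl)) = proj₁ xy , ˡ xy , ʳ xy
        go (inj₁ refl)        (inj₂ (inj₂ refl)) = proj₁ zx , ʳ zx , ˡ zx
        go (inj₂ (inj₁ refl)) (inj₁ refl)        = proj₁ xy , ʳ xy , ˡ xy
        go (inj₂ (inj₁ refl)) (inj₂ (inj₁ refl)) = proj₁ xy , ʳ xy , ʳ xy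
        go (inj₂ (inj₁ refl)) (inj₂ (inj₂ refl)) = proj₁ yz , ˡ yz , ʳ yz
        go (inj₂ (inj₂ refl)) (inj₁ refl)        = proj₁ zx , ˡ zx , ʳ zx
        go (inj₂ (inj₂ refl)) (inj₂ (inj₁ refl)) = proj₁ yz , ʳ yz , ˡ yz
        go (inj₂ (inj₂ refl)) (inj₂ (inj₂ refl)) = proj₁ yz , ʳ yz , ʳ yz

      x-not-leaf : ¬ Leaf x
      x-not-leaf leaf = y≢z (leaf x~y (Graph.adj-sym H z~x))

      y-not-leaf : ¬ Leaf y
      y-not-leaf leaf = z≢x (leaf y~z (Graph.adj-sym H x~y))

      z-not-leaf : ¬ Leaf z
      z-not-leaf leaf = x≢y (leaf z~x (Graph.adj-sym H y~z))

      colour-avoids : ∀ q → colour q ≢ z × ¬ Leaf (colour q)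
      colour-avoids q with colour-spec q
      ... | inj₁ (_ , inj₁ c≡x) = (λ c≡z → z≢x (trans (sym c≡z) c≡x)) ,
                                  subst (λ v → ¬ Leaf v) (sym c≡x) x-not-leaf
      ... | inj₁ (_ , inj₂ c≡y) = (λ c≡z → y≢z (trans (sym c≡y) c≡z)) ,
                                  subst (λ v → ¬ Leaf v) (sym c≡y) y-not-leaf
      ... | inj₂ (¬in , c≡p)    = (λ c≡z → ¬in (inj₂ (inj₂ (trans (sym c≡p) c≡z)))) ,
                                  subst (λ v → ¬ Leaf v) (sym c≡p) (pivot-not-leaf q)

    triangle-bound : ∀ {r} → IsRainbowConnectionNumber K r → ∀ {S} → Unique S → All Leaf S →
                     r + suc (length S) ≤ order H
    triangle-bound rc {S} uS leaves =
      recoloured-bound colour (Corner x y z) close (λ {q} {f} → reflects {q} {f})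
        (triangle-detour x≢y oriented) rc {z ∷ S}
        (All.¬Any⇒All¬ S (λ z∈S → z-not-leaf (All.lookup leaves z∈S)) ∷ uS)
        λ { q (here c≡z)   → proj₁ (colour-avoids q) c≡z
          ; q (there c∈S) → proj₂ (colour-avoids q) (All.lookup leaves c∈S) }

ordered-pair : ∀ {n} {a c p q a′ c′ : Fin n} → a Fin.< c → a′ Fin.< c′ →
               (a ≡ p × c ≡ q) ⊎ (a ≡ q × c ≡ p) →
               (a′ ≡ p × c′ ≡ q) ⊎ (a′ ≡ q × c′ ≡ p) → a ≡ a′ × c ≡ c′
ordered-pair <₁ <₂ (inj₁ (refl , refl)) (inj₁ (refl , refl)) = refl , refl
ordered-pair <₁ <₂ (inj₁ (refl , refl)) (inj₂ (refl , refl)) = contradiction <₂ (Fin.<-asym <₁)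
ordered-pair <₁ <₂ (inj₂ (refl , refl)) (inj₁ (refl , refl)) = contradiction <₂ (Fin.<-asym <₁)
ordered-pair <₁ <₂ (inj₂ (refl , refl)) (inj₂ (refl , refl)) = refl , refl

module PendentPaths (G : Graph) where
  private
    L = lineGraph G
    module EG = Edges G
    module L² = LineGraphColouring L
    open Graph G using (Joins; degree; adj-sym; PendentTwoPath; pendentTwoPaths; pendentTwoPath?)

  pendents-unique : Unique pendentTwoPaths
  pendents-unique = Unique.filter⁺ _ (Unique.cartesianProduct⁺ (Unique.allFin⁺ _)
    (Unique.cartesianProduct⁺ (Unique.allFin⁺ _) (Unique.allFin⁺ _)))

  pendent : Fin (numPendentTwoPaths G) → V G × V G × V G
  pendent = lookup pendentTwoPaths

  ∈-pendents : ∀ {t} → PendentTwoPath t → t ∈ pendentTwoPaths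
  ∈-pendents {a , b , c} = ∈-filter⁺ pendentTwoPath?
    (∈-cartesianProduct⁺ (∈-allFin a) (∈-cartesianProduct⁺ (∈-allFin b) (∈-allFin c)))

  pendent-spec : ∀ i → PendentTwoPath (pendent i)
  pendent-spec i = proj₂ (∈-filter⁻ pendentTwoPath?
    {xs = cartesianProduct (allFin _) (cartesianProduct (allFin _) (allFin _))} (∈-lookup i))

  pendent-injective : ∀ {i j} → pendent i ≡ pendent j → i ≡ j
  pendent-injective = lookup-injective pendents-unique _ _

  -- The same path seen from its end `p` of degree 1, with pendent edge `e`. As the listing demands
  -- a < c, either end may be `p`, and `ac` records which one.
  record Tip (a b c : V G) : Set where
    field
      e     : E G
      p q   : V G
      joins : Joins e p b
      deg-p : degree p ≡ 1
      deg-b : degree b ≡ 2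
      b~q   : Adj G b q
      p≢q   : p ≢ q
      ac    : (a ≡ p × c ≡ q) ⊎ (a ≡ q × c ≡ p)

  tip : ∀ {a b c} → PendentTwoPath (a , b , c) → Tip a b c
  tip (a<c , a~b , b~c , deg-b , inj₁ deg-a) = record
    { joins = proj₂ (EG.edge-between a~b) ; deg-p = deg-a ; deg-b = deg-b ; b~q = b~c
    ; p≢q = Fin.<⇒≢ a<c ; ac = inj₁ (refl , refl) }
  tip (a<c , a~b , b~c , deg-b , inj₂ deg-c) = record
    { joins = proj₂ (EG.edge-between (adj-sym b~c)) ; deg-p = deg-c ; deg-b = deg-b
    ; b~q = adj-sym a~b ; p≢q = Fin.<⇒≢ a<c ∘ sym ; ac = inj₂ (refl , refl) }

  -- An edge adjacent to `e` cannot meet it at `p`, which has degree 1. So it meets `e` at b, and as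
  -- b has degree 2 it is the edge from b to `q`.
  tip-leaf : ∀ {a b c} (t : Tip a b c) → L².Leaf (Tip.e t)
  tip-leaf {b = b} t {f} {f′} e~f e~f′ = EG.joins-unique {f} {f′} (next f e~f) (next f′ e~f′)
    where
    open Tip t
    next : ∀ f → Adj L e f → Joins f b q
    next f (e≢f , v , v∈e , v∈f) =
      let x , f-vx = EG.incident⇒joins {f} v∈f
          v~x = EG.joins⇒adj {f} f-vx
      in  case EG.incident-joins {e} joins v∈e of λ
            { (inj₁ refl) → contradiction
                (EG.joins-unique {e} {f} joins (subst (Joins f p)
                  (EG.degree-1 deg-p v~x (EG.joins⇒adj {e} joins)) f-vx)) e≢f
            ; (inj₂ refl) →
                case EG.degree-2 deg-b (adj-sym (EG.joins⇒adj {e} joins)) b~q p≢q v~x of λ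
                  { (inj₁ refl) → contradiction (EG.joins-unique {e} {f} joins (swap f-vx)) e≢f
                  ; (inj₂ refl) → f-vx } }

  -- The degrees 1 and 2 tell the ends of `e` apart, and `q` is the other neighbour of the end of
  -- degree 2. So the pendent edge determines the path.
  tip-injective : ∀ {a b c a′ b′ c′} (t : Tip a b c) (t′ : Tip a′ b′ c′) →
                  a Fin.< c → a′ Fin.< c′ → Tip.e t ≡ Tip.e t′ → (a , b , c) ≡ (a′ , b′ , c′)
  tip-injective {a} {b} {c} {a′} {b′} {c′} t t′ a<c a′<c′ e≡e′ =
    let a≡a′ , c≡c′ = ordered-pair a<c a′<c′ T.ac
          (subst₂ (λ p q → (a′ ≡ p × c′ ≡ q) ⊎ (a′ ≡ q × c′ ≡ p)) p′≡p q′≡q T′.ac)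
    in  cong₂ _,_ a≡a′ (cong₂ _,_ (sym b′≡b) c≡c′)
    where
    module T = Tip t
    module T′ = Tip t′

    j′ : Joins T.e T′.p b′
    j′ = subst (λ e → Joins e T′.p b′) (sym e≡e′) T′.joins

    1≢2 : 1 ≢ 2
    1≢2 ()

    p′≡p : T′.p ≡ T.p
    p′≡p with EG.incident-joins {T.e} T.joins (EG.joins⇒incidentˡ {T.e} j′)
    ... | inj₁ eq = eq
    ... | inj₂ eq = contradiction (trans (sym T′.deg-p) (trans (cong degree eq) T.deg-b)) 1≢2

    b′≡b : b′ ≡ b
    b′≡b with EG.incident-joins {T.e} T.joins (EG.joins⇒incidentʳ {T.e} j′)
    ... | inj₁ eq = contradiction (trans (sym T.deg-p) (trans (cong degree (sym eq)) T′.deg-b)) 1≢2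
    ... | inj₂ eq = eq

    q′≡q : T′.q ≡ T.q
    q′≡q with EG.degree-2 T.deg-b (adj-sym (EG.joins⇒adj {T.e} T.joins)) T.b~q T.p≢q
                (subst (λ b → Adj G b T′.q) b′≡b T′.b~q)
    ... | inj₁ eq = contradiction (trans p′≡p (sym eq)) T′.p≢q
    ... | inj₂ eq = eq

  leaf-edge : Fin (numPendentTwoPaths G) → E G
  leaf-edge i = Tip.e (tip (pendent-spec i))

  leaf-edge-injective : ∀ {i j} → leaf-edge i ≡ leaf-edge j → i ≡ j
  leaf-edge-injective {i} {j} eq = pendent-injective
    (tip-injective (tip (pendent-spec i)) (tip (pendent-spec j))
      (proj₁ (pendent-spec i)) (proj₁ (pendent-spec j)) eq)

  leaf-edges : List (E G)
  leaf-edges = tabulate leaf-edge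

  leaf-edges-unique : Unique leaf-edges
  leaf-edges-unique = Unique.tabulate⁺ leaf-edge-injective

  leaf-edges-leaves : All L².Leaf leaf-edges
  leaf-edges-leaves = All.tabulate⁺ (λ i → tip-leaf (tip (pendent-spec i)))

  module _ {r} (rc : IsRainbowConnectionNumber (lineGraph L) r) where

    pendent-bound : r + numPendentTwoPaths G ≤ size G
    pendent-bound = subst (λ n → r + n ≤ size G) (List.length-tabulate leaf-edge)
      (L².leaf-bound rc leaf-edges-unique leaf-edges-leaves)

    -- Three edges at v are pairwise adjacent and form a triangle in L(G).
    claw-bound : ∀ {v x y z} → Adj G v x → Adj G v y → Adj G v z → x ≢ y → y ≢ z → z ≢ x →
                 r + suc (numPendentTwoPaths G) ≤ size G
    claw-bound {v} v~x v~y v~z x≢y y≢z z≢x =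
      subst (λ n → r + suc n ≤ size G) (List.length-tabulate leaf-edge)
        (L².triangle-bound (spokes v~x v~y x≢y) (spokes v~y v~z y≢z) (spokes v~z v~x z≢x)
          rc leaf-edges-unique leaf-edges-leaves)
      where
      spokes : ∀ {x y} (v~x : Adj G v x) (v~y : Adj G v y) → x ≢ y →
               Adj L (proj₁ (EG.edge-between v~x)) (proj₁ (EG.edge-between v~y))
      spokes {x} {y} v~x v~y x≢y =
        let e , e-vx = EG.edge-between v~x
            f , f-vy = EG.edge-between v~y
        in  EG.distinct-spokes {e} {f} e-vx f-vy x≢y ,
            v , EG.joins⇒incidentˡ {e} e-vx , EG.joins⇒incidentˡ {f} f-vy

-- Maximal paths in a graph without branching vertices

opposite-step : ∀ {k} {i j : Fin (suc k)} → suc (toℕ i) ≡ toℕ j →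
                suc (toℕ (Fin.opposite j)) ≡ toℕ (Fin.opposite i)
opposite-step {k} {i} {j} eq = begin
  suc (toℕ (Fin.opposite j)) ≡⟨ cong suc (Fin.opposite-prop j) ⟩
  suc (k ℕ.∸ toℕ j)          ≡⟨ cong (λ n → suc (k ℕ.∸ n)) eq ⟨
  suc (k ℕ.∸ suc (toℕ i))    ≡⟨ ℕ.+-∸-assoc 1 (subst (ℕ._≤ k) (sym eq) (Fin.toℕ≤pred[n] j)) ⟨
  k ℕ.∸ toℕ i                ≡⟨ Fin.opposite-prop i ⟨
  toℕ (Fin.opposite i)       ∎
  where open ≡-Reasoning

opposite-injective : ∀ {n} {i j : Fin n} → Fin.opposite i ≡ Fin.opposite j → i ≡ j
opposite-injective {i = i} {j} eq = trans (sym (Fin.opposite-involutive i))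
  (trans (cong Fin.opposite eq) (Fin.opposite-involutive j))

module NumberedPaths (G : Graph) where
  private
    module EG = Edges G
    open Graph G using (adj?; adj-sym; irrefl; Walk; []; _∷_)

  Branching : Set
  Branching = ∃[ v ] ∃[ x ] ∃[ y ] ∃[ z ]
    (Adj G v x × Adj G v y × Adj G v z × x ≢ y × y ≢ z × z ≢ x)

  two-neighbours : ¬ Branching → ∀ {v a b c} → Adj G v a → Adj G v b → a ≢ b → Adj G v c →
                   c ≡ a ⊎ c ≡ b
  two-neighbours ¬br {v} {a} {b} {c} va vb a≢b vc with c Fin.≟ a | c Fin.≟ b
  ... | yes c≡a | _       = inj₁ c≡a
  ... | no  _   | yes c≡b = inj₂ c≡b
  ... | no  c≢a | no  c≢b = contradiction (v , a , b , c , va , vb , vc , a≢b , c≢b ∘ sym , c≢a) ¬br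

  record NumberedPath (k : ℕ) : Set where
    field
      at           : Fin (suc k) → V G
      at-injective : ∀ {i j} → at i ≡ at j → i ≡ j
      step         : ∀ {i j} → suc (toℕ i) ≡ toℕ j → Adj G (at i) (at j)

    Visited : V G → Set
    Visited w = ∃[ i ] at i ≡ w

    visited? : ∀ w → Dec (Visited w)
    visited? w = Fin.any? (λ i → at i Fin.≟ w)

    ClosedAt : Fin (suc k) → Set
    ClosedAt i = ∀ w → Adj G (at i) w → Visited w

  open NumberedPath

  trivial : V G → NumberedPath 0
  trivial v = record
    { at = λ _ → v ; at-injective = λ { {zero} {zero} _ → refl }
    ; step = λ { {zero} {zero} () } }

  extend : ∀ {k} (p : NumberedPath k) {w} → Adj G (at p zero) w → ¬ Visited p w →
           NumberedPath (suc k)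
  extend {k} p {w} 0~w w∉p = record
    { at = at′ ; at-injective = λ {i} {j} → inj i j ; step = λ {i} {j} → step′ i j }
    where
    at′ : Fin (suc (suc k)) → V G
    at′ zero    = w
    at′ (suc i) = at p i

    inj : ∀ i j → at′ i ≡ at′ j → i ≡ j
    inj zero    zero    eq = refl
    inj zero    (suc j) eq = contradiction (j , sym eq) w∉p
    inj (suc i) zero    eq = contradiction (i , eq) w∉p
    inj (suc i) (suc j) eq = cong suc (at-injective p eq)

    step′ : ∀ i j → suc (toℕ i) ≡ toℕ j → Adj G (at′ i) (at′ j)
    step′ zero    (suc zero) eq = adj-sym 0~w
    step′ (suc i) (suc j)    eq = step p (ℕ.suc-injective eq)

  reverse : ∀ {k} → NumberedPath k → NumberedPath k
  reverse p = record
    { at = at p ∘ Fin.opposite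
    ; at-injective = opposite-injective ∘ at-injective p
    ; step = λ {i} {j} eq → adj-sym (step p (opposite-step {i = i} {j} eq)) }

  record ClosedPath : Set where
    field
      {len}        : ℕ
      path         : NumberedPath len
      closed-first : ClosedAt path zero
      closed-last  : ClosedAt path (Fin.fromℕ len)

  -- A path is extended at either end (reversing it if necessary) until both ends are stuck.
  closed-path : V G → ClosedPath
  closed-path v = grow (order G) (trivial v) (ℕ.m≤m+n _ 0)
    where
    grow : ∀ d {k} (p : NumberedPath k) → order G ≤ d + k → ClosedPath
    -- The path would have k + 1 distinct vertices in a graph with at most k.
    grow zero    p bound = contradiction (Fin.injective⇒≤ (at-injective p)) (ℕ.≤⇒≯ bound)
    grow (suc d) {k} p bound = result (outside? zero) (outside? (Fin.fromℕ k))
      where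
      Outside : Fin (suc k) → Set
      Outside i = ∃[ w ] (Adj G (at p i) w × ¬ Visited p w)

      outside? : ∀ i → Dec (Outside i)
      outside? i = Fin.any? (λ w → adj? (at p i) w ×-dec ¬? (visited? p w))

      closed : ∀ {i} → ¬ Outside i → ClosedAt p i
      closed ∄ w i~w = decidable-stable (visited? p w) λ w∉ → ∄ (w , i~w , w∉)

      bound′ : order G ≤ d + suc k
      bound′ = subst (order G ≤_) (sym (ℕ.+-suc d k)) bound

      result : Dec (Outside zero) → Dec (Outside (Fin.fromℕ k)) → ClosedPath
      result (yes (w , 0~w , w∉)) _ = grow d (extend p 0~w w∉) bound′
      result (no _) (yes (w , k~w , w∉)) = grow d (extend (reverse p) k~w
        (λ { (i , eq) → w∉ (Fin.opposite i , eq) })) bound′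
      result (no ∄first) (no ∄last) = record
        { path = p ; closed-first = closed ∄first ; closed-last = closed ∄last }

  module Spanning (¬branching : ¬ Branching) (connected : Connected G) (closed : ClosedPath) where
    open ClosedPath closed renaming (len to k)

    Consecutive : Fin (suc k) → Fin (suc k) → Set
    Consecutive = Adj (pathGraph k)

    data Place (j : Fin (suc k)) : Set where
      first : j ≡ zero → Place j
      last  : toℕ j ≡ k → Place j
      inner : ∀ {i l : Fin (suc k)} → suc (toℕ i) ≡ toℕ j → suc (toℕ j) ≡ toℕ l → Place j

    place : ∀ j → Place j
    place zero    = first refl
    place (suc i) with toℕ (suc i) ℕ.≟ k
    ... | yes eq = last eq
    ... | no neq = inner {i = Fin.inject₁ i} {l = Fin.fromℕ< (s≤s j<k)}
          (cong suc (Fin.toℕ-inject₁ i)) (sym (Fin.toℕ-fromℕ< (s≤s j<k)))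
      where
      j<k : toℕ (suc i) ℕ.< k
      j<k = ℕ.≤∧≢⇒< (Fin.toℕ≤pred[n] (suc i)) neq

    neighbours-inner : ∀ {i j l : Fin (suc k)} {w} → suc (toℕ i) ≡ toℕ j → suc (toℕ j) ≡ toℕ l →
                       Adj G (at path j) w → w ≡ at path i ⊎ w ≡ at path l
    neighbours-inner {i} {j} {l} eq eq′ =
      two-neighbours ¬branching (adj-sym (step path {i} {j} eq)) (step path {j} {l} eq′)
        (λ i≡l → ℕ.<⇒≢ (ℕ.n≤1+n (suc (toℕ i)))
          (trans (cong toℕ (at-injective path i≡l)) (trans (sym eq′) (cong suc (sym eq)))))

    -- The ends are stuck by maximality, and an inner vertex already has its two neighbours on the
    -- path. So no walk leaves the path.
    neighbours-visited : ∀ j → ClosedAt path j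
    neighbours-visited j w j~w with place j
    ... | first refl = closed-first w j~w
    ... | last eq    = closed-last w (subst (λ i → Adj G (at path i) w)
                         (Fin.toℕ-injective (trans eq (sym (Fin.toℕ-fromℕ k)))) j~w)
    ... | inner {i} {l} eq eq′ with neighbours-inner {i} {j} {l} eq eq′ j~w
    ...   | inj₁ w≡i = i , sym w≡i
    ...   | inj₂ w≡l = l , sym w≡l

    visited-along : ∀ {u w} → Walk u w → Visited path u → Visited path w
    visited-along []            u∈ = u∈
    visited-along ((e , j) ∷ p) (i , refl) =
      visited-along p (neighbours-visited i _ (EG.joins⇒adj {e} j))

    all-visited : ∀ w → Visited path w
    all-visited w = visited-along (proj₁ (proj₂ connected (at path zero) w)) (zero , refl)

    pos : V G → Fin (suc k)
    pos w = proj₁ (all-visited w)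

    at-pos : ∀ w → at path (pos w) ≡ w
    at-pos w = proj₂ (all-visited w)

    pos-at : ∀ i → pos (at path i) ≡ i
    pos-at i = at-injective path (at-pos (at path i))

    pos-injective : ∀ {u w} → pos u ≡ pos w → u ≡ w
    pos-injective {u} {w} eq = trans (sym (at-pos u)) (trans (cong (at path) eq) (at-pos w))

    -- For k = 1 the ends are adjacent along the path; from k = 2 on, an edge between them is a new
    -- one that closes a cycle.
    Cyclic : Set
    Cyclic = 2 ≤ k × Adj G (at path zero) (at path (Fin.fromℕ k))

    adjacent-ends : ∀ j → toℕ j ≡ k → Adj G (at path zero) (at path j) → Consecutive zero j ⊎ Cyclic
    adjacent-ends zero          eq 0~j = contradiction 0~j (irrefl refl)
    adjacent-ends (suc zero)    eq 0~j = inj₁ (inj₁ refl)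
    adjacent-ends (suc (suc j)) eq 0~j = inj₂
      ( subst (2 ≤_) eq (s≤s (s≤s z≤n))
      , subst (λ i → Adj G (at path zero) (at path i))
          (Fin.toℕ-injective (trans eq (sym (Fin.toℕ-fromℕ k)))) 0~j )

    -- An inner vertex has no neighbours but those next to it on the path, so any other edge must
    -- join the two ends.
    adjacent : ∀ i j → Adj G (at path i) (at path j) → Consecutive i j ⊎ Cyclic
    adjacent i j i~j = go (place i) (place j)
      where
      around : ∀ {i h j l : Fin (suc k)} → suc (toℕ h) ≡ toℕ j → suc (toℕ j) ≡ toℕ l →
               Adj G (at path j) (at path i) → Consecutive j i
      around {i} {h} {j} {l} eq eq′ j~i with neighbours-inner {h} {j} {l} eq eq′ j~i
      ... | inj₁ i≡h = inj₂ (trans (cong (suc ∘ toℕ) (at-injective path i≡h)) eq)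
      ... | inj₂ i≡l = inj₁ (trans eq′ (cong toℕ (sym (at-injective path i≡l))))

      go : Place i → Place j → Consecutive i j ⊎ Cyclic
      go (inner {h} {l} eq eq′) _ = inj₁ (around {j} {h} {i} {l} eq eq′ i~j)
      go _ (inner {h} {l} eq eq′) = inj₁ (swap (around {i} {h} {j} {l} eq eq′ (adj-sym i~j)))
      go (first refl) (first refl) = contradiction i~j (irrefl refl)
      go (first refl) (last eq)    = adjacent-ends j eq i~j
      go (last eq)    (first refl) = Sum.map₁ swap (adjacent-ends i eq (adj-sym i~j))
      go (last eq)    (last eq′)   = contradiction i~j
        (irrefl (cong (at path) (Fin.toℕ-injective (trans eq (sym eq′)))))

    path-isomorphism : ¬ Cyclic → G ≅ pathGraph k
    path-isomorphism acyclic = mk↔ₛ′ pos (at path) pos-at at-pos , λ u w → mk⇔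
      (λ u~w → case adjacent (pos u) (pos w) (subst₂ (Adj G) (sym (at-pos u)) (sym (at-pos w)) u~w) of λ
        { (inj₁ consecutive) → consecutive ; (inj₂ cyclic) → contradiction cyclic acyclic })
      λ { (inj₁ eq) → subst₂ (Adj G) (at-pos u) (at-pos w) (step path eq)
        ; (inj₂ eq) → adj-sym (subst₂ (Adj G) (at-pos w) (at-pos u) (step path eq)) }

-- Pairs of adjacent edges and their common vertices

module Cherries (G : Graph) where
  private
    L = lineGraph G
    K = lineGraph L
    module EG = Edges G
    module EL = Edges L
    module L¹ = LineGraphColouring G
    module L² = LineGraphColouring L
    module KG = Graph K
    open Graph G using (Joins; Incident)
    open Graph L using () renaming (Incident to _∈ᴸ_)
    open NumberedPaths G using (Branching; two-neighbours)

  -- A vertex of L² is a pair of edges of G meeting at a vertex of G.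
  centre : V K → V G
  centre = L¹.pivot

  record Arms (C : V K) : Set where
    field
      {e f}   : E G
      {a b}   : V G
      joins-e : Joins e (centre C) a
      joins-f : Joins f (centre C) b
      a≢b     : a ≢ b
      e≢f     : e ≢ f
      e∈C     : e ∈ᴸ C
      f∈C     : f ∈ᴸ C

  arms : ∀ C → Arms C
  arms C =
    let e , f = Graph.endpoints L C
        j = EL.joins-endpoints C
        e∈C = EL.joins⇒incidentˡ {C} j
        f∈C = EL.joins⇒incidentʳ {C} j
        a , joins-e = EG.incident⇒joins {e} (L¹.pivot-incident {C} e∈C)
        b , joins-f = EG.incident⇒joins {f} (L¹.pivot-incident {C} f∈C)
        e≢f = EL.adjacent-≢ (EL.joins⇒adj {C} j)
    in  record { joins-e = joins-e ; joins-f = joins-f ; e≢f = e≢f ; e∈C = e∈C ; f∈C = f∈C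
               ; a≢b = λ a≡b → e≢f (EG.joins-unique {e} {f} joins-e
                                 (subst (Joins f (centre C)) (sym a≡b) joins-f)) }

  cherry : ∀ {v a b} → Adj G v a → Adj G v b → a ≢ b → ∃[ C ] centre C ≡ v
  cherry va vb a≢b =
    let e , e-va = EG.edge-between va
        f , f-vb = EG.edge-between vb
        C , _ , centre≡v = L¹.link (EG.distinct-spokes {e} {f} e-va f-vb a≢b)
          (EG.joins⇒incidentˡ {e} e-va) (EG.joins⇒incidentˡ {f} f-vb)
    in  C , centre≡v

  -- Adjacent pairs share an edge of G, and both centres lie on that edge.
  centre-step : ∀ {q C D} → KG.Joins q C D → centre C ≡ centre D ⊎ Adj G (centre C) (centre D)
  centre-step {q} {C} {D} j = go (centre C Fin.≟ centre D)
    where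
    go : Dec (centre C ≡ centre D) → centre C ≡ centre D ⊎ Adj G (centre C) (centre D)
    go (yes eq) = inj₁ eq
    go (no neq) = inj₂ (EG.joins⇒adj {L².pivot q} (EG.incident²⇒joins {L².pivot q} neq
      (L¹.pivot-incident {C} (L².pivot∈ˡ {q} j)) (L¹.pivot-incident {D} (L².pivot∈ʳ {q} j))))

  module _ (¬branching : ¬ Branching) where

    -- The pair already holds two edges at its centre, and without branching there is no third. Thus
    -- the centre determines the pair.
    centre-incident : ∀ {C e} → Incident (centre C) e → e ∈ᴸ C
    centre-incident {C} {e} v∈e =
      let c , e-vc = EG.incident⇒joins {e} v∈e
      in  case two-neighbours ¬branching (EG.joins⇒adj {A.e} A.joins-e)
                 (EG.joins⇒adj {A.f} A.joins-f) A.a≢b (EG.joins⇒adj {e} e-vc) of λ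
            { (inj₁ c≡a) → subst (_∈ᴸ C) (EG.joins-unique {A.e} {e} A.joins-e
                (subst (Joins e (centre C)) c≡a e-vc)) A.e∈C
            ; (inj₂ c≡b) → subst (_∈ᴸ C) (EG.joins-unique {A.f} {e} A.joins-f
                (subst (Joins e (centre C)) c≡b e-vc)) A.f∈C }
      where module A = Arms (arms C)

    centre-injective : ∀ {C D} → centre C ≡ centre D → C ≡ D
    centre-injective {C} {D} eq = EL.edge-unique {C} {D} A.e≢f A.e∈C A.f∈C
      (centre-incident {D} (subst (λ v → Incident v A.e) eq (EG.joins⇒incidentˡ {A.e} A.joins-e)))
      (centre-incident {D} (subst (λ v → Incident v A.f) eq (EG.joins⇒incidentˡ {A.f} A.joins-f)))
      where module A = Arms (arms C)

    centre-adjacent : ∀ {C D} → Adj G (centre C) (centre D) → Σ[ q ∈ E K ] KG.Joins q C D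
    centre-adjacent {C} {D} c~d =
      let e , j = EG.edge-between c~d
          q , q-CD , _ = L².link (λ C≡D → EG.adjacent-≢ c~d (cong centre C≡D))
            (centre-incident {C} (EG.joins⇒incidentˡ {e} j))
            (centre-incident {D} (EG.joins⇒incidentʳ {e} j))
      in  q , q-CD

-- Cycles

⊓-< : ∀ {m n k} → m ≢ n → m ≤ k → n ≤ k → m ℕ.⊓ n ℕ.< k
⊓-< {m} {n} m≢n m≤k n≤k with ℕ.<-cmp m n
... | tri< m<n _ _ = ℕ.≤-trans (ℕ.≤-<-trans (ℕ.m⊓n≤m m n) m<n) n≤k
... | tri≈ _ m≡n _ = contradiction m≡n m≢n
... | tri> _ _ n<m = ℕ.≤-trans (ℕ.≤-<-trans (ℕ.m⊓n≤n m n) n<m) m≤k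

module Cycle (G : Graph) (¬branching : ¬ NumberedPaths.Branching G) (connected : Connected G)
             (closed : NumberedPaths.ClosedPath G)
             (cyclic : NumberedPaths.Spanning.Cyclic G ¬branching connected closed) where
  private
    K = lineGraph (lineGraph G)
    module EG = Edges G
    module EK = Edges K
  open Graph K using (Walk; []; _∷_; walkEdges; Joins; endpoints)
  open NumberedPaths G
  open NumberedPath
  open ClosedPath closed renaming (len to k)
  open Spanning ¬branching connected closed
  open Cherries G

  two-arms : ∀ j → ∃[ a ] ∃[ b ] (Adj G (at path j) a × Adj G (at path j) b × a ≢ b)
  two-arms j = go j (place j)
    where
    go : ∀ j → Place j → ∃[ a ] ∃[ b ] (Adj G (at path j) a × Adj G (at path j) b × a ≢ b)
    go j (inner {i} {l} eq eq′) = at path i , at path l ,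
      Graph.adj-sym G (step path {i} {j} eq) , step path {j} {l} eq′ ,
      λ i≡l → ℕ.<⇒≢ (ℕ.n≤1+n (suc (toℕ i)))
        (trans (cong toℕ (at-injective path i≡l)) (trans (sym eq′) (cong suc (sym eq))))
    go .zero (first refl) = at path one , at path (Fin.fromℕ k) ,
      step path {zero} {one} (sym (Fin.toℕ-fromℕ< 1<)) , proj₂ cyclic ,
      λ 1≡k → ℕ.<⇒≢ (proj₁ cyclic) (trans (sym (Fin.toℕ-fromℕ< 1<))
        (trans (cong toℕ (at-injective path 1≡k)) (Fin.toℕ-fromℕ k)))
      where
      1< : 1 ℕ.< suc k
      1< = s≤s (ℕ.≤-trans (s≤s z≤n) (proj₁ cyclic))
      one = Fin.fromℕ< 1<
    go zero (last 0≡k) = contradiction (subst (2 ≤_) (sym 0≡k) (proj₁ cyclic)) λ ()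
    go (suc i) (last eq) = at path (Fin.inject₁ i) , at path zero ,
      Graph.adj-sym G (step path (cong suc (Fin.toℕ-inject₁ i))) ,
      subst (λ j → Adj G (at path j) (at path zero))
        (Fin.toℕ-injective (trans (Fin.toℕ-fromℕ k) (sym eq))) (Graph.adj-sym G (proj₂ cyclic)) ,
      λ i≡0 → ℕ.<⇒≢ (proj₁ cyclic) (trans (cong suc (trans (cong toℕ (sym (at-injective path i≡0)))
        (Fin.toℕ-inject₁ i))) eq)

  -- Every vertex of the cycle has two neighbours, so none has degree 1.
  no-pendents : numPendentTwoPaths G ≡ 0
  no-pendents = empty λ i →
    let _ , _ , _ , _ , d = PendentPaths.pendent-spec G i in [ not-1 , not-1 ]′ d
    where
    empty : ∀ {n} → (Fin n → ⊥) → n ≡ 0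
    empty {zero}  _ = refl
    empty {suc n} f = contradiction zero f

    not-1 : ∀ {v} → Graph.degree G v ≢ 1
    not-1 {v} d =
      let _ , _ , va , vb , a≢b = subst (λ v → ∃[ a ] ∃[ b ] (Adj G v a × Adj G v b × a ≢ b))
                                    (at-pos v) (two-arms (pos v))
      in  a≢b (EG.degree-1 d va vb)

  path-step : (i : Fin k) → Adj G (at path (Fin.inject₁ i)) (at path (suc i))
  path-step i = step path {Fin.inject₁ i} {suc i} (cong suc (Fin.toℕ-inject₁ i))

  cycle-edge : Fin (suc k) → E G
  cycle-edge zero    = proj₁ (EG.edge-between (proj₂ cyclic))
  cycle-edge (suc i) = proj₁ (EG.edge-between (path-step i))

  cycle-edge-injective : ∀ {i j} → cycle-edge i ≡ cycle-edge j → i ≡ j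
  cycle-edge-injective {i} {j} = go i j
    where
    Ends : E G → Fin (suc k) → Fin (suc k) → Set
    Ends e i j = Graph.Joins G e (at path i) (at path j)

    closing : Ends (cycle-edge zero) zero (Fin.fromℕ k)
    closing = proj₂ (EG.edge-between (proj₂ cyclic))

    along : ∀ i → Ends (cycle-edge (suc i)) (Fin.inject₁ i) (suc i)
    along i = proj₂ (EG.edge-between (path-step i))

    match : ∀ {e f i j i′ j′} → e ≡ f → Ends e i j → Ends f i′ j′ →
            (i ≡ i′ ⊎ i ≡ j′) × (j ≡ i′ ⊎ j ≡ j′)
    match {e} {f} refl e-ij f-ij =
      Sum.map (at-injective path) (at-injective path)
        (EG.incident-joins {f} f-ij (EG.joins⇒incidentˡ {e} e-ij)) ,
      Sum.map (at-injective path) (at-injective path)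
        (EG.incident-joins {f} f-ij (EG.joins⇒incidentʳ {e} e-ij))

    not-closing : ∀ i → cycle-edge zero ≢ cycle-edge (suc i)
    not-closing i eq with match (sym eq) (along i) closing
    -- A path edge from position 0 to position k forces k = 1.
    ... | inj₁ i≡0 , inj₂ i+1≡k = ℕ.<⇒≢ (proj₁ cyclic) (begin
            1                         ≡⟨ cong (suc ∘ toℕ) i≡0 ⟨
            suc (toℕ (Fin.inject₁ i)) ≡⟨ cong suc (Fin.toℕ-inject₁ i) ⟩
            suc (toℕ i)               ≡⟨ cong toℕ i+1≡k ⟩
            toℕ (Fin.fromℕ k)         ≡⟨ Fin.toℕ-fromℕ k ⟩
            k                         ∎)
            where open ≡-Reasoning
    ... | inj₂ i≡k , inj₂ i+1≡k = ℕ.<⇒≢ ℕ.≤-refl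
            (trans (sym (Fin.toℕ-inject₁ i)) (cong toℕ (trans i≡k (sym i+1≡k))))

    go : ∀ i j → cycle-edge i ≡ cycle-edge j → i ≡ j
    go zero    zero    eq = refl
    go zero    (suc j) eq = contradiction eq (not-closing j)
    go (suc i) zero    eq = contradiction (sym eq) (not-closing i)
    go (suc i) (suc j) eq with match eq (along i) (along j)
    ... | inj₁ i≡j   , _          = cong suc (Fin.inject₁-injective i≡j)
    ... | inj₂ i≡j+1 , inj₂ eq′   = eq′
    ... | inj₂ i≡j+1 , inj₁ i+1≡j = contradiction
            (trans (sym (Fin.toℕ-inject₁ i)) (cong toℕ i≡j+1))
            λ i≡1+j → ℕ.<⇒≢ (ℕ.n≤1+n (suc (toℕ j))) (sym (trans (cong suc (sym i≡1+j))
              (trans (cong toℕ i+1≡j) (Fin.toℕ-inject₁ j))))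

  k<size : suc k ≤ size G
  k<size = Fin.injective⇒≤ cycle-edge-injective

  height : V K → ℕ
  height C = toℕ (pos (centre C))

  height≤k : ∀ C → height C ≤ k
  height≤k C = Fin.toℕ≤pred[n] (pos (centre C))

  height-injective : ∀ {C D} → height C ≡ height D → C ≡ D
  height-injective eq = centre-injective ¬branching (pos-injective (Fin.toℕ-injective eq))

  cherry-at : ∀ {n} → n ≤ k → ∃[ C ] height C ≡ n
  cherry-at n≤k =
    let _ , _ , ja , jb , a≢b = two-arms (Fin.fromℕ< (s≤s n≤k))
        C , centre≡ = cherry ja jb a≢b
    in  C , trans (cong (toℕ ∘ pos) centre≡) (trans (cong toℕ (pos-at _)) (Fin.toℕ-fromℕ< (s≤s n≤k)))

  -- The closing edge of the cycle gets the colour 0 of the first edge: the rainbow walks avoid it.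
  abstract
    level : E K → ℕ
    level q = height (proj₁ (endpoints q)) ℕ.⊓ height (proj₂ (endpoints q))

    level-joins : ∀ {q C D} → Joins q C D → level q ≡ height C ℕ.⊓ height D
    level-joins (inj₁ eq) = cong (λ (C , D) → height C ℕ.⊓ height D) eq
    level-joins {C = C} {D} (inj₂ eq) =
      trans (cong (λ (C , D) → height C ℕ.⊓ height D) eq) (ℕ.⊓-comm (height D) (height C))

    -- The two ends have different heights, both at most k, so the smaller is below k. Hence k
    -- colours are enough.
    level<k : ∀ q → level q ℕ.< k
    level<k q = ⊓-<
      (λ eq → EK.adjacent-≢ (EK.joins⇒adj {q} (EK.joins-endpoints q)) (height-injective eq))
      (height≤k _) (height≤k _)

  step-up : ∀ C D → height D ≡ suc (height C) → Σ[ q ∈ E K ] (Joins q C D × level q ≡ height C)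
  step-up C D eq =
    let q , j = centre-adjacent ¬branching (subst₂ (Adj G) (at-pos _) (at-pos _) (step path (sym eq)))
    in  q , j , trans (level-joins {q} j) (ℕ.m≤n⇒m⊓n≡m (subst (height C ≤_) (sym eq) (ℕ.n≤1+n _)))

  -- The lower bound on the levels makes the first edge, whose level is the height of C, differ in
  -- colour from all later ones.
  walk-up : ∀ d C D → height D ≡ d + height C →
            Σ[ w ∈ Walk C D ] (Unique (map level (walkEdges w)) ×
                               All (λ q → height C ≤ level q) (walkEdges w))
  walk-up zero C D eq = same (height-injective (sym eq))
    where
    same : ∀ {D} → C ≡ D → Σ[ w ∈ Walk C D ]
      (Unique (map level (walkEdges w)) × All (λ q → height C ≤ level q) (walkEdges w))
    same refl = [] , [] , []
  walk-up (suc d) C D eq =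
    let X , X≡ = cherry-at (ℕ.≤-trans (s≤s (ℕ.m≤n+m (height C) d)) (subst (_≤ k) eq (height≤k D)))
        q , j , lq = step-up C X X≡
        w , u , low = walk-up d X D (trans eq (trans (sym (ℕ.+-suc d _)) (cong (d +_) (sym X≡))))
        C<X = ℕ.≤-reflexive (sym X≡)
    in  (q , j) ∷ w ,
        All.map⁺ (All.map (λ X≤ → ℕ.<⇒≢ (ℕ.≤-trans (subst (ℕ._< height X) (sym lq) C<X) X≤)) low) ∷ u ,
        ℕ.≤-reflexive (sym lq) ∷ All.map (ℕ.≤-trans (ℕ.<⇒≤ C<X)) low

  -- Here the first edge has the level of X, one below C, and all later levels are smaller still.
  walk-down : ∀ d C D → height C ≡ d + height D →
              Σ[ w ∈ Walk C D ] (Unique (map level (walkEdges w)) ×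
                                 All (λ q → level q ℕ.< height C) (walkEdges w))
  walk-down zero C D eq = same (height-injective eq)
    where
    same : ∀ {D} → C ≡ D → Σ[ w ∈ Walk C D ]
      (Unique (map level (walkEdges w)) × All (λ q → level q ℕ.< height C) (walkEdges w))
    same refl = [] , [] , []
  walk-down (suc d) C D eq =
    let X , X≡ = cherry-at (ℕ.≤-trans (ℕ.n≤1+n _) (subst (_≤ k) eq (height≤k C)))
        C≡1+X = trans eq (cong suc (sym X≡))
        q , j , lq = step-up X C C≡1+X
        w , u , high = walk-down d X D X≡
        X<C = ℕ.≤-reflexive (sym C≡1+X)
    in  (q , swap j) ∷ w ,
        All.map⁺ (All.map (λ <X q≡ → ℕ.<⇒≢ <X (trans (sym q≡) lq)) high) ∷ u ,
        subst (ℕ._< height C) (sym lq) X<C ∷ All.map (λ <X → ℕ.<-trans <X X<C) high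

  cycle-bound : ∀ {r} → IsRainbowConnectionNumber K r → r + suc (numPendentTwoPaths G) ≤ size G
  cycle-bound {r} rc = begin
    r + suc (numPendentTwoPaths G) ≡⟨ cong (λ n → r + suc n) no-pendents ⟩
    r + 1                          ≡⟨ ℕ.+-comm r 1 ⟩
    suc r                          ≡⟨ cong suc (ℕ.+-identityʳ r) ⟨
    suc (r + 0)                    ≤⟨ s≤s (Walks.rc-bound K colour rainbow rc {[]} [] (λ _ ())) ⟩
    suc k                          ≤⟨ k<size ⟩
    size G                         ∎
    where
    open ℕ.≤-Reasoning

    colour : E K → Fin k
    colour q = Fin.fromℕ< (level<k q)

    colour⇒level : ∀ {q f} → colour q ≡ colour f → level q ≡ level f
    colour⇒level {q} {f} eq =
      trans (sym (Fin.toℕ-fromℕ< (level<k q))) (trans (cong toℕ eq) (Fin.toℕ-fromℕ< (level<k f)))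

    rainbow : ∀ C D → Σ[ w ∈ Walk C D ] Unique (map colour (walkEdges w))
    rainbow C D = [ up , down ]′ (ℕ.≤-total (height C) (height D))
      where
      up : height C ≤ height D → Σ[ w ∈ Walk C D ] Unique (map colour (walkEdges w))
      up C≤D = let w , u , _ = walk-up _ C D (sym (ℕ.m∸n+n≡m C≤D))
               in  w , map-unique {f = level} {colour} (λ {q} {f} → colour⇒level {q} {f}) u
      down : height D ≤ height C → Σ[ w ∈ Walk C D ] Unique (map colour (walkEdges w))
      down D≤C = let w , u , _ = walk-down _ C D (sym (ℕ.m∸n+n≡m D≤C))
                 in  w , map-unique {f = level} {colour} (λ {q} {f} → colour⇒level {q} {f}) u

-- Paths of length at least 3 attain the bound

flip : ∀ {G ℓ} → G ≅ pathGraph ℓ → G ≅ pathGraph ℓ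
flip {G} {ℓ} (f , f-adj) =
  mk↔ₛ′ (Fin.opposite ∘ to) (from ∘ Fin.opposite)
    (λ i → trans (cong Fin.opposite (strictlyInverseˡ (Fin.opposite i))) (Fin.opposite-involutive i))
    (λ u → trans (cong from (Fin.opposite-involutive (to u))) (strictlyInverseʳ u)) ,
  λ u w → mk⇔
    (λ u~w → opposite-adj (to u) (to w) (Equivalence.to (f-adj u w) u~w))
    (λ adj → Equivalence.from (f-adj u w) (subst₂ (Adj (pathGraph ℓ))
      (Fin.opposite-involutive (to u)) (Fin.opposite-involutive (to w))
      (opposite-adj (Fin.opposite (to u)) (Fin.opposite (to w)) adj)))
  where
  open Inverse f
  opposite-adj : ∀ i j → Adj (pathGraph ℓ) i j → Adj (pathGraph ℓ) (Fin.opposite i) (Fin.opposite j)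
  opposite-adj i j (inj₁ eq) = inj₂ (opposite-step {i = i} {j} eq)
  opposite-adj i j (inj₂ eq) = inj₁ (opposite-step {i = j} {i} eq)

module PathNumbering (G : Graph) {ℓ} (iso : G ≅ pathGraph ℓ) where
  private
    module EG = Edges G
  open Graph G using (Joins)

  pos : V G → Fin (suc ℓ)
  pos = Inverse.to (proj₁ iso)

  at : Fin (suc ℓ) → V G
  at = Inverse.from (proj₁ iso)

  pos-at : ∀ i → pos (at i) ≡ i
  pos-at = Inverse.strictlyInverseˡ (proj₁ iso)

  at-pos : ∀ u → at (pos u) ≡ u
  at-pos = Inverse.strictlyInverseʳ (proj₁ iso)

  pos-injective : ∀ {u w} → pos u ≡ pos w → u ≡ w
  pos-injective {u} {w} eq = trans (sym (at-pos u)) (trans (cong at eq) (at-pos w))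

  at-injective : ∀ {i j} → at i ≡ at j → i ≡ j
  at-injective {i} {j} eq = trans (sym (pos-at i)) (trans (cong pos eq) (pos-at j))

  consecutive : ∀ {u w} → Adj G u w → Adj (pathGraph ℓ) (pos u) (pos w)
  consecutive {u} {w} = Equivalence.to (proj₂ iso u w)

  consecutive-at : ∀ {i w} → Adj G (at i) w → Adj (pathGraph ℓ) i (pos w)
  consecutive-at {i} {w} i~w = subst (λ j → Adj (pathGraph ℓ) j (pos w)) (pos-at i) (consecutive i~w)

  at-adjacent : ∀ {i j} → suc (toℕ i) ≡ toℕ j → Adj G (at i) (at j)
  at-adjacent {i} {j} eq = Equivalence.from (proj₂ iso (at i) (at j))
    (inj₁ (subst₂ (λ i j → suc (toℕ i) ≡ toℕ j) (sym (pos-at i)) (sym (pos-at j)) eq))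

  edge-position : ∀ e → Σ[ i ∈ Fin ℓ ] Joins e (at (Fin.inject₁ i)) (at (suc i))
  edge-position e = go (consecutive (EG.joins⇒adj {e} (EG.joins-endpoints e)))
    where
    u = proj₁ (Graph.endpoints G e)
    w = proj₂ (Graph.endpoints G e)

    -- The later end is not at position 0; splitting `j` exposes its predecessor, which numbers the
    -- edge.
    forward : ∀ {u w} → Joins e u w → ∀ j → pos w ≡ j → suc (toℕ (pos u)) ≡ toℕ j →
              Σ[ i ∈ Fin ℓ ] Joins e (at (Fin.inject₁ i)) (at (suc i))
    forward {u} {w} e-uw (suc i) w≡ eq = i , subst₂ (Joins e)
      (pos-injective (trans (Fin.toℕ-injective (trans (ℕ.suc-injective eq) (sym (Fin.toℕ-inject₁ i))))
        (sym (pos-at (Fin.inject₁ i)))))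
      (pos-injective (trans w≡ (sym (pos-at (suc i))))) e-uw

    go : Adj (pathGraph ℓ) (pos u) (pos w) → Σ[ i ∈ Fin ℓ ] Joins e (at (Fin.inject₁ i)) (at (suc i))
    go (inj₁ eq) = forward (EG.joins-endpoints e) (pos w) refl eq
    go (inj₂ eq) = forward (swap (EG.joins-endpoints e)) (pos u) refl eq

  size-≤ : size G ≤ ℓ
  size-≤ = Fin.injective⇒≤ {f = proj₁ ∘ edge-position} λ {e} {f} eq →
    EG.joins-unique {e} {f} (proj₂ (edge-position e))
      (subst (λ i → Joins f (at (Fin.inject₁ i)) (at (suc i))) (sym eq) (proj₂ (edge-position f)))

module LongPath (G : Graph) {n} (iso : G ≅ pathGraph (3 + n)) where
  private
    module EG = Edges G
  open Graph G using (adj-sym; degree; PendentTwoPath)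
  open PathNumbering G iso

  v₀ v₁ v₂ : V G
  v₀ = at zero
  v₁ = at (suc zero)
  v₂ = at (suc (suc zero))

  v₀~v₁ : Adj G v₀ v₁
  v₀~v₁ = at-adjacent refl

  v₁~v₂ : Adj G v₁ v₂
  v₁~v₂ = at-adjacent refl

  v₀≢v₂ : v₀ ≢ v₂
  v₀≢v₂ eq = case at-injective eq of λ ()

  degree-v₀ : degree v₀ ≡ 1
  degree-v₀ = ℕ.≤-antisym
    (EG.degree-≤-length {xs = v₁ ∷ []} λ {w} a → here (only w (consecutive-at a)))
    (EG.length-≤-degree ([] ∷ []) λ { (here refl) → v₀~v₁ })
    where
    only : ∀ w → Adj (pathGraph (3 + n)) zero (pos w) → w ≡ v₁
    only w (inj₁ eq) = pos-injective (trans (Fin.toℕ-injective (sym eq)) (sym (pos-at (suc zero))))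

  degree-v₁ : degree v₁ ≡ 2
  degree-v₁ = ℕ.≤-antisym
    (EG.degree-≤-length {xs = v₀ ∷ v₂ ∷ []} λ {w} a → only w (consecutive-at a))
    (EG.length-≤-degree ((v₀≢v₂ ∷ []) ∷ [] ∷ [])
      λ { (here refl) → adj-sym v₀~v₁ ; (there (here refl)) → v₁~v₂ })
    where
    only : ∀ w → Adj (pathGraph (3 + n)) (suc zero) (pos w) → w ∈ v₀ ∷ v₂ ∷ []
    only w (inj₁ eq) = there (here (pos-injective
      (trans (Fin.toℕ-injective (sym eq)) (sym (pos-at (suc (suc zero)))))))
    only w (inj₂ eq) = here (pos-injective
      (trans (Fin.toℕ-injective (ℕ.suc-injective eq)) (sym (pos-at zero))))

  -- The middle vertex is recorded since it tells apart the pendent paths at the two ends.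
  pendent-at-v₁ : ∃[ t ] (PendentTwoPath t × proj₁ (proj₂ t) ≡ v₁)
  pendent-at-v₁ with Fin.<-cmp v₀ v₂
  ... | tri< lt _ _ = (v₀ , v₁ , v₂) , (lt , v₀~v₁ , v₁~v₂ , degree-v₁ , inj₁ degree-v₀) , refl
  ... | tri≈ _ eq _ = contradiction eq v₀≢v₂
  ... | tri> _ _ gt = (v₂ , v₁ , v₀) ,
        (gt , adj-sym v₁~v₂ , adj-sym v₀~v₁ , degree-v₁ , inj₂ degree-v₀) , refl

  cherry-at-v₁ : ∃[ C ] Cherries.centre G C ≡ v₁
  cherry-at-v₁ = Cherries.cherry G (adj-sym v₀~v₁) v₁~v₂ v₀≢v₂

module LongPathBound (G : Graph) {n} (iso : G ≅ pathGraph (3 + n)) where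
  private
    K = lineGraph (lineGraph G)
    module Front = LongPath G iso
    -- Reversing the numbering turns the facts about the first end into facts about the last.
    module Back  = LongPath G (flip {G} iso)
  open PathNumbering G iso
  open Graph K using (Walk; []; _∷_; walkEdges)
  open Walks K using (∣_∣)
  open Cherries G

  pos-back : pos Back.v₁ ≡ Fin.opposite (suc zero)
  pos-back = pos-at _

  toℕ-back : toℕ (pos Back.v₁) ≡ 2 + n
  toℕ-back = trans (cong toℕ pos-back) (Fin.opposite-prop {suc (3 + n)} (suc zero))

  two-pendents : 2 ≤ numPendentTwoPaths G
  two-pendents =
    let t , p , t≡ = Front.pendent-at-v₁
        t′ , p′ , t′≡ = Back.pendent-at-v₁
        t≢t′ = λ t≡t′ → case trans (sym (cong toℕ (pos-at (suc zero)))) (trans (cong (toℕ ∘ pos)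
                 (trans (sym t≡) (trans (cong (λ t → proj₁ (proj₂ t)) t≡t′) t′≡))) toℕ-back) of λ ()
    in  length-⊆ {xs = t ∷ t′ ∷ []} ((t≢t′ ∷ []) ∷ [] ∷ [])
          λ { (here refl) → PendentPaths.∈-pendents G p
            ; (there (here refl)) → PendentPaths.∈-pendents G p′ }

  height : V K → ℕ
  height C = toℕ (pos (centre C))

  height-step : ∀ {q C D} → Graph.Joins K q C D → height D ≤ suc (height C)
  height-step {q} {C} {D} j = go (centre-step {q} {C} {D} j)
    where
    go : centre C ≡ centre D ⊎ Adj G (centre C) (centre D) → height D ≤ suc (height C)
    go (inj₁ eq) = ℕ.≤-trans (ℕ.≤-reflexive (cong (toℕ ∘ pos) (sym eq))) (ℕ.n≤1+n _)
    go (inj₂ c~d) = [ (λ eq → ℕ.≤-reflexive (sym eq))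
                    , (λ eq → ℕ.m≤n⇒m≤1+n (ℕ.<⇒≤ (ℕ.≤-reflexive eq))) ]′ (consecutive c~d)

  height-walk : ∀ {C D} (w : Walk C D) → height D ≤ ∣ w ∣ + height C
  height-walk []            = ℕ.≤-refl
  height-walk {C} {D} (_∷_ {v = X} (q , j) w) = begin
    height D             ≤⟨ height-walk w ⟩
    ∣ w ∣ + height X     ≤⟨ ℕ.+-monoʳ-≤ ∣ w ∣ (height-step {q} {C} {X} j) ⟩
    ∣ w ∣ + suc (height C) ≡⟨ ℕ.+-suc ∣ w ∣ (height C) ⟩
    suc (∣ w ∣ + height C) ∎
    where open ℕ.≤-Reasoning

  -- Heights 1 and 2 + n are n + 1 apart, so a rainbow path between these pairs needs n + 1 colours.
  -- The two pendent paths make up the rest of 3 + n.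
  size-bound : ∀ {r} → IsRainbowConnectionNumber K r → size G ≤ r + numPendentTwoPaths G
  size-bound {r} (_ , (c , rainbow) , _) =
    let C , C≡ = Front.cherry-at-v₁
        D , D≡ = Back.cherry-at-v₁
        w , _ , u = rainbow C D
    in  begin
      size G                     ≤⟨ size-≤ ⟩
      suc (2 + n)                ≡⟨ cong suc (trans (cong (toℕ ∘ pos) D≡) toℕ-back) ⟨
      suc (height D)             ≤⟨ s≤s (height-walk w) ⟩
      suc (∣ w ∣ + height C)     ≡⟨ cong (λ h → suc (∣ w ∣ + h))
                                     (trans (cong (toℕ ∘ pos) C≡) (cong toℕ (pos-at (suc zero)))) ⟩
      suc (∣ w ∣ + 1)            ≡⟨ ℕ.+-suc ∣ w ∣ 1 ⟨
      ∣ w ∣ + 2                  ≤⟨ ℕ.+-mono-≤ (subst (_≤ r) (List.length-map c (walkEdges w)) (length-Fin u))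
                                     two-pendents ⟩
      r + numPendentTwoPaths G   ∎
    where open ℕ.≤-Reasoning

-- Paths of length at most 2 miss the bound

distinct⇒2≤ : ∀ {n} {i j : Fin n} → i ≢ j → 2 ≤ n
distinct⇒2≤ i≢j = length-Fin ((i≢j ∷ []) ∷ [] ∷ [])

two-distinct : ∀ {n} → 2 ≤ n → Σ[ i ∈ Fin n ] Σ[ j ∈ Fin n ] i ≢ j
two-distinct (s≤s (s≤s _)) = zero , suc zero , λ ()

middle : ∀ {i j l} → Adj (pathGraph 2) i j → Adj (pathGraph 2) i l → j ≢ l → i ≡ suc zero
middle {zero}         (inj₁ eq) (inj₁ eq′) j≢l = contradiction (Fin.toℕ-injective (trans (sym eq) eq′)) j≢l
middle {suc zero}     _ _ _ = refl
middle {suc (suc zero)} {zero}         (inj₂ ()) _ _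
middle {suc (suc zero)} {suc zero} {zero}         _ (inj₂ ()) _
middle {suc (suc zero)} {suc zero} {suc zero}     _ _ j≢l = contradiction refl j≢l
middle {suc (suc zero)} {suc zero} {suc (suc zero)} _ (inj₂ ()) _
middle {suc (suc zero)} {suc (suc zero)} (inj₂ ()) _ _

module ShortPath (G : Graph) (¬branching : ¬ NumberedPaths.Branching G)
                 {r} (rc : IsRainbowConnectionNumber (lineGraph (lineGraph G)) r) where
  private
    K = lineGraph (lineGraph G)
    module EG = Edges G
    module EK = Edges K
  open Graph K using (Walk; []; walkEdges)
  open Cherries G
  open NumberedPaths G using (two-neighbours)

  -- Connectedness of L² provides a vertex of it, which is a pair of different edges of G.
  two-edges : 2 ≤ size G
  two-edges = distinct⇒2≤ (Arms.e≢f (arms (proj₁ (proj₁ rc))))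

  module _ (iso : G ≅ pathGraph 2) where
    open PathNumbering G iso

    one-middle : ∀ {u a b v c d} → Adj G u a → Adj G u b → a ≢ b →
                 Adj G v c → Adj G v d → c ≢ d → u ≡ v
    one-middle {a = a} {b} {c = c} {d} ua ub a≢b vc vd c≢d = pos-injective
      (trans (middle {j = pos a} {pos b} (consecutive ua) (consecutive ub) (a≢b ∘ pos-injective))
        (sym (middle {j = pos c} {pos d} (consecutive vc) (consecutive vd) (c≢d ∘ pos-injective))))

    one-cherry : ∀ C D → C ≡ D
    one-cherry C D = centre-injective ¬branching (one-middle
      (EG.joins⇒adj {A.e} A.joins-e) (EG.joins⇒adj {A.f} A.joins-f) A.a≢b
      (EG.joins⇒adj {B.e} B.joins-e) (EG.joins⇒adj {B.f} B.joins-f) B.a≢b)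
      where
      module A = Arms (arms C)
      module B = Arms (arms D)

    -- L² has a single vertex and hence no edges to colour.
    rc≡0 : r ≤ 0
    rc≡0 = ℕ.≤-trans (ℕ.m≤m+n r 0) (Walks.rc-bound K {m = 0} colour
      (λ C D → trivial (one-cherry C D)) rc {[]} [] (λ _ ()))
      where
      colour : E K → Fin 0
      colour q = contradiction (one-cherry _ _) (EK.adjacent-≢ (EK.joins⇒adj {q} (EK.joins-endpoints q)))

      trivial : ∀ {C D} → C ≡ D → Σ[ w ∈ Walk C D ] Unique (map colour (walkEdges w))
      trivial refl = [] , []

    one-pendent : ∀ i j → i ≡ j
    one-pendent i j = pendent-injective (same (pendent-spec i) (pendent-spec j))
      where
      open PendentPaths G
      same : ∀ {t t′} → Graph.PendentTwoPath G t → Graph.PendentTwoPath G t′ → t ≡ t′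
      same {a , b , c} {a′ , b′ , c′} (a<c , ab , bc , _) (a′<c′ , a′b′ , b′c′ , _)
        with one-middle (Graph.adj-sym G ab) bc (Fin.<⇒≢ a<c) (Graph.adj-sym G a′b′) b′c′ (Fin.<⇒≢ a′<c′)
      ... | refl = let a≡ , c≡ = ordered-pair a<c a′<c′ (inj₁ (refl , refl))
                                   (pair (two-neighbours ¬branching ba bc a≢c (Graph.adj-sym G a′b′))
                                         (two-neighbours ¬branching ba bc a≢c b′c′))
                   in  cong₂ _,_ a≡ (cong (b ,_) c≡)
        where
        ba = Graph.adj-sym G ab
        a≢c = Fin.<⇒≢ a<c
        pair : a′ ≡ a ⊎ a′ ≡ c → c′ ≡ a ⊎ c′ ≡ c → (a′ ≡ a × c′ ≡ c) ⊎ (a′ ≡ c × c′ ≡ a)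
        pair (inj₁ p) (inj₂ q) = inj₁ (p , q)
        pair (inj₂ p) (inj₁ q) = inj₂ (p , q)
        pair (inj₁ p) (inj₁ q) = contradiction (trans p (sym q)) (Fin.<⇒≢ a′<c′)
        pair (inj₂ p) (inj₂ q) = contradiction (trans p (sym q)) (Fin.<⇒≢ a′<c′)

    -- With r = 0 and at least two edges, equality would demand two different pendent paths. But the
    -- middle vertex is forced, and its two neighbours are listed in increasing order only.
    path2-strict : r + numPendentTwoPaths G ≢ size G
    path2-strict eq =
      let i , j , i≢j = two-distinct (ℕ.≤-trans two-edges
            (ℕ.≤-trans (ℕ.≤-reflexive (sym eq)) (ℕ.+-monoˡ-≤ (numPendentTwoPaths G) rc≡0)))
      in  i≢j (one-pendent i j)

  short-strict : ∀ k → G ≅ pathGraph k → r + numPendentTwoPaths G ≡ size G → 3 ≤ k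
  short-strict 0 iso _ = contradiction (ℕ.≤-trans two-edges (PathNumbering.size-≤ G iso)) λ ()
  short-strict 1 iso _ = contradiction (ℕ.≤-trans two-edges (PathNumbering.size-≤ G iso)) λ { (s≤s ()) }
  short-strict 2 iso eq = contradiction eq (path2-strict iso)
  short-strict (suc (suc (suc k))) _ _ = s≤s (s≤s (s≤s z≤n))

-- The bound is written additively because subtraction on ℕ is truncated.
theorem4p2 : (G : Graph) → Connected G → (r : ℕ) →
    IsRainbowConnectionNumber (lineGraph (lineGraph G)) r →
    (r + numPendentTwoPaths G ≤ size G) ×
    ((r + numPendentTwoPaths G ≡ size G) ⇔ IsPathOfLength≥3 G)
theorem4p2 G connected r rc = pendent-bound rc , mk⇔ equality⇒path path⇒equality
  where
  open PendentPaths G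
  open NumberedPaths G

  -- `claw-bound` and `cycle-bound` are better than `pendent-bound` by one, so equality excludes
  -- branching vertices and cycles.
  not-strict : r + numPendentTwoPaths G ≡ size G → ¬ (r + suc (numPendentTwoPaths G) ≤ size G)
  not-strict eq lt = ℕ.<-irrefl eq (subst (_≤ size G) (ℕ.+-suc r (numPendentTwoPaths G)) lt)

  equality⇒path : r + numPendentTwoPaths G ≡ size G → IsPathOfLength≥3 G
  equality⇒path eq = k , ShortPath.short-strict G ¬branching rc k iso eq , iso
    where
    ¬branching : ¬ Branching
    ¬branching (_ , _ , _ , _ , v~x , v~y , v~z , x≢y , y≢z , z≢x) =
      not-strict eq (claw-bound rc v~x v~y v~z x≢y y≢z z≢x)

    closed : ClosedPath
    closed = closed-path (proj₁ connected)

    open ClosedPath closed using () renaming (len to k)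

    iso : G ≅ pathGraph k
    iso = Spanning.path-isomorphism ¬branching connected closed
      λ cyclic → not-strict eq (Cycle.cycle-bound G ¬branching connected closed cyclic rc)

  path⇒equality : IsPathOfLength≥3 G → r + numPendentTwoPaths G ≡ size G
  path⇒equality (_ , s≤s (s≤s (s≤s z≤n)) , iso) =
    ℕ.≤-antisym (pendent-bound rc) (LongPathBound.size-bound G iso rc)
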